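{- Let $d\in\mathbb N$. A sequence $(G_n)$ of finite graphs with maximum degree at most $d$ such that $\lim_{n\to\infty}|G_n|=\infty$ is FO-convergent if and only if it is both BS-convergent and elementarily convergent.
   Context: $\langle\phi,G\rangle=|\{(v_1,\dots,v_p)\in V(G)^p:G\models\phi(v_1,\dots,v_p)\}|/|G|^p$ for a first-order formula $\phi$ with free variables among $x_1,\dots,x_p$; $(G_n)$ is FO-convergent if $\langle\phi,G_n\rangle$ converges for every first-order $\phi$, and elementarily convergent if for every first-order sentence $\theta$, either $G_n\models\theta$ for all sufficiently large $n$ or $G_n\not\models\theta$ for all sufficiently large $n$. $(G_n)$ is BS-convergent if for every integer $r$ and every finite rooted connected graph $(F,o)$ with maximum degree at most $d$, $\lim_{n\to\infty}|\{v:(B_{G_n}(v,r),v)\cong(F,o)\}|/|G_n|$ exists, where $B_G(v,r)$ is the subgraph induced by the vertices at distance at most $r$ from $v$. -}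

module Defs where

open import Data.Fin.Base using (Fin)
import Data.Fin.Properties as Fin
open import Data.Integer.Base using (+_)
open import Data.Irrelevant using ([_])
open import Data.List.Base using (List; []; _∷_; length; filter; allFin; cartesianProductWith)
open import Data.List.Membership.Propositional using (_∈_; find; lose)
open import Data.List.Membership.Propositional.Properties
  using (∈-allFin; ∈-cartesianProductWith⁺)
open import Data.List.Relation.Unary.Any using (here; any?)
open import Data.Nat.Base using (ℕ; zero; suc; _≤_; _^_; NonZero; z≤n; s≤s)
open import Data.Nat.Properties using (m^n≢0; anyUpTo?; m<1+n⇒m≤n)
open import Data.Product.Base using (∃; _×_; _,_; proj₁; proj₂)
open import Data.Rational.Base as ℚ using (ℚ; 0ℚ; _/_)
open import Data.Refinement using (Refinement; _,_; value; value-injective)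
open import Data.Sum.Base using (_⊎_)
open import Data.Vec.Base using (Vec; []; _∷_; lookup; tabulate)
open import Data.Vec.Properties using (lookup∘tabulate)
open import Function.Bundles using (_↔_; _⇔_; mk↔ₛ′; mk⇔; Inverse; Equivalence)
open import Level using (0ℓ)
open import Relation.Binary.Core using (Rel)
open import Relation.Binary.Definitions using (Irreflexive; Symmetric)
import Relation.Binary.Definitions as B
open import Relation.Binary.PropositionalEquality
  using (_≡_; refl; sym; trans; cong; subst; subst₂)
open import Relation.Nullary.Decidable
  using (Dec; map′; recompute; ¬?; _×-dec_; _⊎-dec_; _→-dec_)
open import Relation.Nullary.Negation using (¬_)
open import Relation.Unary using (Pred; Decidable)

------------------------------------------------------------------------
-- Limits of sequences of rationals

Eventually : Pred ℕ 0ℓ → Set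
Eventually P = ∃ λ N → ∀ n → N ≤ n → P n

IsCauchy : (ℕ → ℚ) → Set
IsCauchy a = ∀ ε → 0ℚ ℚ.< ε →
  ∃ λ N → ∀ m n → N ≤ m → N ≤ n → ℚ.∣ a m ℚ.- a n ∣ ℚ.< ε

-- Real numbers, represented by Cauchy sequences of rationals.
record ℝ : Set where
  field
    approx   : ℕ → ℚ
    isCauchy : IsCauchy approx

-- |q - x| < ε, with the usual strict order on Cauchy reals: the approximations
-- of |q - x| are eventually bounded by a rational δ < ε.
∣_-_∣<_ : ℚ → ℝ → ℚ → Set
∣ q - x ∣< ε = ∃ λ δ → δ ℚ.< ε ×
  Eventually (λ k → ℚ.∣ q ℚ.- ℝ.approx x k ∣ ℚ.≤ δ)

_⟶_ : (ℕ → ℚ) → ℝ → Set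
a ⟶ x = ∀ ε → 0ℚ ℚ.< ε → Eventually (λ n → ∣ a n - x ∣< ε)

Converges : (ℕ → ℚ) → Set
Converges a = ∃ λ x → a ⟶ x

------------------------------------------------------------------------
-- Graphs

record Graph (V : Set) : Set₁ where
  field
    _~_      : Rel V 0ℓ
    ~-irrefl : Irreflexive _≡_ _~_
    ~-sym    : Symmetric _~_

-- The vertex set is nonempty, so that densities are defined.
record FiniteGraph : Set₁ where
  field
    order        : ℕ
    {{nonEmpty}} : NonZero order
    graph        : Graph (Fin order)
  open Graph graph public
  field
    _~?_ : B.Decidable _~_

  Vertex : Set
  Vertex = Fin order

open FiniteGraph using (order; graph; Vertex)

module _ {V : Set} (G : Graph V) where
  open Graph G

  data Walk : ℕ → V → V → Set where
    done : ∀ {u} → Walk zero u u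
    step : ∀ {k u v w} → u ~ v → Walk k v w → Walk (suc k) u w

  Dist≤ : ℕ → V → V → Set
  Dist≤ r u v = ∃ λ k → k ≤ r × Walk k u v

  Connected : Set
  Connected = ∀ u v → ∃ λ k → Walk k u v

  -- The vertices of an induced subgraph carry their membership proof
  -- irrelevantly, so they are equal exactly when equal in the ambient graph.
  induced : (P : Pred V 0ℓ) → Graph (Refinement V P)
  induced P = record
    { _~_      = λ x y → value x ~ value y
    ; ~-irrefl = λ x≡y → ~-irrefl (cong value x≡y)
    ; ~-sym    = ~-sym
    }

  BallVertex : V → ℕ → Set
  BallVertex v r = Refinement V (Dist≤ r v)

  ball : (v : V) (r : ℕ) → Graph (BallVertex v r)
  ball v r = induced (Dist≤ r v)

  centre : (v : V) (r : ℕ) → BallVertex v r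
  centre v r = v , [ (zero , z≤n , done) ]

RootedGraph : Set → Set₁
RootedGraph V = Graph V × V

record _≅_ {V W : Set} (G : RootedGraph V) (H : RootedGraph W) : Set where
  private
    module G = Graph (proj₁ G)
    module H = Graph (proj₁ H)
  field
    bijection : V ↔ W
  open Inverse bijection public using (to; from)
  field
    adjacency : ∀ x y → (x G.~ y) ⇔ (to x H.~ to y)
    root      : to (proj₂ G) ≡ proj₂ H

------------------------------------------------------------------------
-- First-order logic of graphs

infix  9 _≐_ _adj_
infixr 8 ¬′_ ∀′_ ∃′_
infixr 7 _∧′_
infixr 6 _∨′_

-- Formula p: formulas with free variables among p variables, in de Bruijn
-- notation; the variable bound by a quantifier is numbered zero.
data Formula : ℕ → Set where
  _≐_ _adj_ : ∀ {p} → Fin p → Fin p → Formula p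
  ¬′_       : ∀ {p} → Formula p → Formula p
  _∧′_ _∨′_ : ∀ {p} → Formula p → Formula p → Formula p
  ∀′_ ∃′_   : ∀ {p} → Formula (suc p) → Formula p

Sentence : Set
Sentence = Formula 0

infix 4 _⊨_[_]

_⊨_[_] : ∀ {V p} → Graph V → Formula p → Vec V p → Set
G ⊨ i ≐ j   [ ρ ] = lookup ρ i ≡ lookup ρ j
G ⊨ i adj j [ ρ ] = Graph._~_ G (lookup ρ i) (lookup ρ j)
G ⊨ ¬′ φ    [ ρ ] = ¬ (G ⊨ φ [ ρ ])
G ⊨ φ ∧′ ψ  [ ρ ] = G ⊨ φ [ ρ ] × G ⊨ ψ [ ρ ]
G ⊨ φ ∨′ ψ  [ ρ ] = G ⊨ φ [ ρ ] ⊎ G ⊨ ψ [ ρ ]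
G ⊨ ∀′ φ    [ ρ ] = ∀ v → G ⊨ φ [ v ∷ ρ ]
G ⊨ ∃′ φ    [ ρ ] = ∃ λ v → G ⊨ φ [ v ∷ ρ ]

------------------------------------------------------------------------
-- Counting

count : {A : Set} {P : Pred A 0ℓ} → Decidable P → List A → ℕ
count P? xs = length (filter P? xs)

tuples : (n p : ℕ) → List (Vec (Fin n) p)
tuples n zero    = [] ∷ []
tuples n (suc p) = cartesianProductWith _∷_ (allFin n) (tuples n p)

∈-tuples : ∀ {n p} (ρ : Vec (Fin n) p) → ρ ∈ tuples n p
∈-tuples []      = here refl
∈-tuples (v ∷ ρ) = ∈-cartesianProductWith⁺ _∷_ (∈-allFin v) (∈-tuples ρ)

anyTuple? : ∀ {n p} {P : Pred (Vec (Fin n) p) 0ℓ} → Decidable P → Dec (∃ P)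
anyTuple? {n} {p} P? =
  map′ (λ any → let (ρ , _ , pρ) = find any in ρ , pρ)
       (λ (ρ , pρ) → lose (∈-tuples ρ) pρ)
       (any? P? (tuples n p))

------------------------------------------------------------------------
-- Decision procedures on finite graphs

module _ (G : FiniteGraph) where
  open FiniteGraph G using (_~_; _~?_)

  sat? : ∀ {p} (φ : Formula p) → Decidable (graph G ⊨ φ [_])
  sat? (i ≐ j)   ρ = lookup ρ i Fin.≟ lookup ρ j
  sat? (i adj j) ρ = lookup ρ i ~? lookup ρ j
  sat? (¬′ φ)    ρ = ¬? (sat? φ ρ)
  sat? (φ ∧′ ψ)  ρ = sat? φ ρ ×-dec sat? ψ ρ
  sat? (φ ∨′ ψ)  ρ = sat? φ ρ ⊎-dec sat? ψ ρ
  sat? (∀′ φ)    ρ = Fin.all? (λ v → sat? φ (v ∷ ρ))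
  sat? (∃′ φ)    ρ = Fin.any? (λ v → sat? φ (v ∷ ρ))

  walk? : ∀ k u v → Dec (Walk (graph G) k u v)
  walk? zero    u v = map′ (λ { refl → done }) (λ { done → refl }) (u Fin.≟ v)
  walk? (suc k) u w =
    map′ (λ (_ , e , p) → step e p) (λ { (step e p) → _ , e , p })
         (Fin.any? (λ v → (u ~? v) ×-dec walk? k v w))

  dist≤? : ∀ r u v → Dec (Dist≤ (graph G) r u v)
  dist≤? r u v =
    map′ (λ (k , k<1+r , p) → k , m<1+n⇒m≤n k<1+r , p)
         (λ (k , k≤r , p) → k , s≤s k≤r , p)
         (anyUpTo? (λ k → walk? k u v) (suc r))

module _ (G : FiniteGraph) (v : Vertex G) (r : ℕ) (F : FiniteGraph) (o : Vertex F) where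
  private
    module G = FiniteGraph G
    module F = FiniteGraph F

    Ball : Pred (Vertex G) 0ℓ
    Ball = Dist≤ (graph G) r v

    ball? : Decidable Ball
    ball? = dist≤? G r v

    -- The inverse of a rooted isomorphism from the ball onto F, as a table.
    IsInverse : Vec (Vertex G) (order F) → Set
    IsInverse e =
      (∀ x → Ball (lookup e x)) ×
      (∀ x y → lookup e x ≡ lookup e y → x ≡ y) ×
      (∀ u → Ball u → ∃ λ x → lookup e x ≡ u) ×
      (∀ x y → lookup e x G.~ lookup e y → x F.~ y) ×
      (∀ x y → x F.~ y → lookup e x G.~ lookup e y) ×
      lookup e o ≡ v

    isInverse? : Decidable IsInverse
    isInverse? e =
      Fin.all? (λ x → ball? (lookup e x)) ×-dec
      Fin.all? (λ x → Fin.all? λ y → (lookup e x Fin.≟ lookup e y) →-dec (x Fin.≟ y)) ×-dec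
      Fin.all? (λ u → ball? u →-dec Fin.any? λ x → lookup e x Fin.≟ u) ×-dec
      Fin.all? (λ x → Fin.all? λ y → (lookup e x G.~? lookup e y) →-dec (x F.~? y)) ×-dec
      Fin.all? (λ x → Fin.all? λ y → (x F.~? y) →-dec (lookup e x G.~? lookup e y)) ×-dec
      (lookup e o Fin.≟ v)

    Iso : Set
    Iso = (ball (graph G) v r , centre (graph G) v r) ≅ (graph F , o)

    inBall : (u : BallVertex (graph G) v r) → Ball (value u)
    inBall (u , [ p ]) = recompute (ball? u) p

    fromTable : ∃ IsInverse → Iso
    fromTable (e , mem , inj , surj , adj⁺ , adj⁻ , root) = record
      { bijection = mk↔ₛ′ to from to∘from from∘to
      ; adjacency = λ x y → mk⇔
          (λ x~y → adj⁺ _ _ (subst₂ G._~_ (sym (e∘to x)) (sym (e∘to y)) x~y))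
          (λ a → subst₂ G._~_ (e∘to x) (e∘to y) (adj⁻ _ _ a))
      ; root = inj _ _ (trans (e∘to (centre (graph G) v r)) (sym root))
      }
      where
      to : BallVertex (graph G) v r → Vertex F
      to u = proj₁ (surj (value u) (inBall u))

      e∘to : ∀ u → lookup e (to u) ≡ value u
      e∘to u = proj₂ (surj (value u) (inBall u))

      from : Vertex F → BallVertex (graph G) v r
      from x = lookup e x , [ mem x ]

      to∘from : ∀ x → to (from x) ≡ x
      to∘from x = inj _ _ (e∘to (from x))

      from∘to : ∀ u → from (to u) ≡ u
      from∘to u = value-injective (e∘to u)

    toTable : Iso → ∃ IsInverse
    toTable iso = tabulate f
      , (λ x → subst Ball (sym (e≡f x)) (inBall (I.from x)))
      , (λ x y eq → f-inj (trans (sym (e≡f x)) (trans eq (e≡f y))))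
      , (λ u p → I.to (u , [ p ]) ,
           trans (e≡f _) (cong value (Bij.strictlyInverseʳ (u , [ p ]))))
      , (λ x y a → subst₂ F._~_ (Bij.strictlyInverseˡ x) (Bij.strictlyInverseˡ y)
           (Equivalence.to (I.adjacency (I.from x) (I.from y))
             (subst₂ G._~_ (e≡f x) (e≡f y) a)))
      , (λ x y a → subst₂ G._~_ (sym (e≡f x)) (sym (e≡f y))
           (Equivalence.from (I.adjacency (I.from x) (I.from y))
             (subst₂ F._~_ (sym (Bij.strictlyInverseˡ x)) (sym (Bij.strictlyInverseˡ y)) a)))
      , trans (e≡f o) (cong value
           (trans (cong I.from (sym I.root)) (Bij.strictlyInverseʳ (centre (graph G) v r))))
      where
      module I = _≅_ iso
      module Bij = Inverse I.bijection

      f : Vertex F → Vertex G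
      f x = value (I.from x)

      e≡f : ∀ x → lookup (tabulate f) x ≡ f x
      e≡f = lookup∘tabulate f

      f-inj : ∀ {x y} → f x ≡ f y → x ≡ y
      f-inj {x} {y} eq = trans (sym (Bij.strictlyInverseˡ x))
        (trans (cong I.to (value-injective eq)) (Bij.strictlyInverseˡ y))

  ball≅? : Dec ((ball (graph G) v r , centre (graph G) v r) ≅ (graph F , o))
  ball≅? = map′ fromTable toTable (anyTuple? isInverse?)

------------------------------------------------------------------------
-- Degrees, densities and the modes of convergence

degree : (G : FiniteGraph) → Vertex G → ℕ
degree G v = count (v ~?_) (allFin (order G))
  where open FiniteGraph G using (_~?_)

MaxDegree≤ : ℕ → FiniteGraph → Set
MaxDegree≤ d G = ∀ v → degree G v ≤ d

⟨_,_⟩ : ∀ {p} → Formula p → FiniteGraph → ℚ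
⟨_,_⟩ {p} φ G = (+ count (sat? G φ) (tuples (order G) p) / (order G ^ p)) {{m^n≢0 (order G) p}}

ballDensity : ℕ → (F : FiniteGraph) → Vertex F → FiniteGraph → ℚ
ballDensity r F o G = + count (λ v → ball≅? G v r F o) (allFin (order G)) / order G

OrderTendsToInfinity : (ℕ → FiniteGraph) → Set
OrderTendsToInfinity G = ∀ k → Eventually (λ n → k ≤ order (G n))

FOConvergent : (ℕ → FiniteGraph) → Set
FOConvergent G = ∀ {p} (φ : Formula p) → Converges (λ n → ⟨ φ , G n ⟩)

BSConvergent : ℕ → (ℕ → FiniteGraph) → Set₁
BSConvergent d G = ∀ (r : ℕ) (F : FiniteGraph) (o : Vertex F) →
  Connected (graph F) → MaxDegree≤ d F → Converges (λ n → ballDensity r F o (G n))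

ElementarilyConvergent : (ℕ → FiniteGraph) → Set
ElementarilyConvergent G = ∀ (θ : Sentence) →
  Eventually (λ n → graph (G n) ⊨ θ [ [] ]) ⊎ Eventually (λ n → ¬ (graph (G n) ⊨ θ [ [] ]))

{-# OPTIONS --safe #-}

-- On graphs of bounded degree a first-order formula is local: for large n its
-- truth at a tuple ρ of vertices of G n depends only on the isomorphism type of
-- the r-neighbourhood of ρ. This follows by induction on formulas. For a
-- quantifier, a witness close to ρ is transported by the isomorphism; a witness
-- a far from ρ is replaced by a vertex b far from the other tuple whose ball is
-- isomorphic to that of a. Such a b exists because "at least k vertices have a
-- ball of this type" is a sentence, whose truth eventually does not change, and
-- the isomorphism matches the vertices of this type close to the two tuples.
--
-- As |G n| → ∞, the vertices of all but a vanishing proportion of the p-tuples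
-- are pairwise far apart. The truth of φ at such a tuple depends only on the
-- types of its p balls, so the density of φ is, up to a vanishing error, a sum
-- of products of ball densities.
--
-- Conversely, "the r-ball of x is isomorphic to (F , o)" is a formula, and the
-- density of a sentence is 0 or 1.

module Submission where

open import Defs
open import Algebra.Bundles using (CommutativeRing)
import Algebra.Properties.Semiring.Sum as SemiringSum
open import Data.Bool.Base using (Bool; true; false; T; _∨_; if_then_else_)
open import Data.Bool.Properties using (T-∨; T?; ∨-comm)
open import Data.Empty using (⊥-elim)
open import Data.Fin.Base using (Fin; zero; suc; _↑ˡ_; _↑ʳ_)
import Data.Fin.Properties as Fin
open import Data.Integer.Base as ℤ using (+_; -[1+_])
import Data.Integer.Properties as ℤ
open import Data.Irrelevant using ([_])
open import Data.List.Base as List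
  using (List; []; _∷_; length; filter; allFin; concatMap; cartesianProduct; cartesianProductWith; upTo)
open import Data.List.Membership.Propositional using (_∈_; find; lose)
open import Data.List.Membership.Propositional.Properties
open import Data.List.Properties using (length-++; length-map; length-tabulate; filter-++)
open import Data.List.Relation.Binary.Subset.Propositional using (_⊆_)
open import Data.List.Relation.Unary.All as All using (All; []; _∷_)
import Data.List.Relation.Unary.All.Properties as All
open import Data.List.Relation.Unary.AllPairs using (AllPairs; []; _∷_)
open import Data.List.Relation.Unary.Any as Any using (Any; here; there; index; any?)
open import Data.List.Relation.Unary.Any.Properties using (lookup-index)
open import Data.List.Relation.Unary.Unique.Propositional using (Unique)
import Data.List.Relation.Unary.Unique.Propositional.Properties as Unique
open import Data.Nat.Base as ℕ using (ℕ; zero; suc; _⊔_; NonZero; z≤n; s≤s)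
open import Data.Nat.Coprimality using (Coprime)
import Data.Nat.Properties as ℕ
open import Data.Product.Base using (∃; _×_; _,_; proj₁; proj₂)
open import Data.Product.Function.NonDependent.Propositional using (_×-⇔_)
open import Data.Rational.Base as ℚ
  using (ℚ; mkℚ; 0ℚ; 1ℚ; ½; _/_; _+_; _-_; _*_; _≤_; _<_; ∣_∣; toℚᵘ)
import Data.Rational.Properties as ℚ
open import Data.Rational.Solver using (module +-*-Solver)
import Data.Rational.Unnormalised.Base as ℚᵘ
import Data.Rational.Unnormalised.Properties as ℚᵘ
open import Data.Refinement using (value; value-injective; _,_)
open import Data.Sum.Base as Sum using (_⊎_; inj₁; inj₂; [_,_]′)
open import Data.Sum.Function.Propositional using (_⊎-⇔_)
open import Data.Unit.Base using (⊤; tt)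
open import Data.Vec.Base as Vec using (Vec; []; _∷_; lookup; tabulate; _++_)
open import Data.Vec.Properties using (lookup∘tabulate; lookup-++ˡ; lookup-++ʳ; ≡-dec; ∷-injective)
open import Function.Base using (_∘_; id)
open import Function.Bundles using (_⇔_; mk↔ₛ′; mk⇔; Inverse; Equivalence)
open import Function.Construct.Composition using (_⇔-∘_)
open import Function.Related.TypeIsomorphisms using (¬-cong-⇔)
open import Level using (0ℓ)
open import Relation.Binary.PropositionalEquality
open import Relation.Nullary.Decidable
  using (Dec; yes; no; map′; does; recompute; ¬?; _×-dec_; _⊎-dec_; dec-true; decidable-stable)
open import Relation.Nullary.Negation using (¬_; contradiction)
open import Relation.Unary using (Pred; Decidable)

open FiniteGraph using (order; graph; Vertex)
open SemiringSum (CommutativeRing.semiring ℚ.+-*-commutativeRing)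
  using (sum; sum-cong-≗; ∑-comm; *-distribˡ-sum; *-distribʳ-sum)
open +-*-Solver using (solve; _:=_; _:+_; _:-_; _:*_; :-_)

-- A quantifier turns the radius `r` into `3r + 1`. A witness within `2r + 1` of the tuple keeps its
-- `r`-ball inside the larger neighbourhood; beyond `2r + 1` its ball neither meets the balls of the
-- tuple nor is joined to them by an edge, so isomorphisms can be glued. The index from which a
-- formula is local has to serve all tuples at once. This is where the degree bound enters: it
-- leaves finitely many ball types and bounds the number of vertices close to a `p`-tuple, so only
-- finitely many counting sentences have to settle. No limit object is built. Two late graphs are
-- always compared with each other, and convergence is obtained as the Cauchy property. The function
-- of ball types that approximates the truth of a formula therefore varies with the pair of graphs,
-- and the estimate for independent samples has to be uniform over all functions of the types
-- bounded by 1. Locality draws on elementary convergence alone; BS-convergence enters only through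
-- the frequencies of the types.

lookup-injective : {A : Set} {xs : List A} → Unique xs →
  ∀ i j → List.lookup xs i ≡ List.lookup xs j → i ≡ j
lookup-injective (px ∷ u) zero    zero    eq = refl
lookup-injective (px ∷ u) zero    (suc j) eq = contradiction eq (All.lookup px (∈-lookup j))
lookup-injective (px ∷ u) (suc i) zero    eq = contradiction (sym eq) (All.lookup px (∈-lookup i))
lookup-injective (px ∷ u) (suc i) (suc j) eq = cong suc (lookup-injective u i j eq)

Unique-⊆⇒length≤ : {A : Set} {xs ys : List A} → Unique xs → xs ⊆ ys → length xs ℕ.≤ length ys
Unique-⊆⇒length≤ {xs = xs} {ys} u xs⊆ys = Fin.injective⇒≤ {f = position} injective
  where
  position : Fin (length xs) → Fin (length ys)
  position i = index (xs⊆ys (∈-lookup i))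

  injective : ∀ {i j} → position i ≡ position j → i ≡ j
  injective {i} {j} eq = lookup-injective u i j
    (trans (lookup-index (xs⊆ys (∈-lookup i)))
      (trans (cong (List.lookup ys) eq) (sym (lookup-index (xs⊆ys (∈-lookup j))))))

-- Walks and distances

module _ {V : Set} {G : Graph V} where
  open Graph G

  walk-++ : ∀ {j k u v w} → Walk G j u v → Walk G k v w → Walk G (j ℕ.+ k) u w
  walk-++ done       q = q
  walk-++ (step e p) q = step e (walk-++ p q)

  walk-reverse : ∀ {k u v} → Walk G k u v → Walk G k v u
  walk-reverse done = done
  walk-reverse {suc k} {u} {v} (step e p) =
    subst (λ l → Walk G l v u) (ℕ.+-comm k 1) (walk-++ (walk-reverse p) (step (~-sym e) done))

  dist-refl : ∀ {r u} → Dist≤ G r u u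
  dist-refl = 0 , z≤n , done

  dist-sym : ∀ {r u v} → Dist≤ G r u v → Dist≤ G r v u
  dist-sym (k , k≤r , p) = k , k≤r , walk-reverse p

  dist-trans : ∀ {r s u v w} → Dist≤ G r u v → Dist≤ G s v w → Dist≤ G (r ℕ.+ s) u w
  dist-trans (j , j≤r , p) (k , k≤s , q) = j ℕ.+ k , ℕ.+-mono-≤ j≤r k≤s , walk-++ p q

  dist-mono : ∀ {r s u v} → r ℕ.≤ s → Dist≤ G r u v → Dist≤ G s u v
  dist-mono r≤s (k , k≤r , p) = k , ℕ.≤-trans k≤r r≤s , p

  dist-step : ∀ {r u v w} → u ~ v → Dist≤ G r v w → Dist≤ G (suc r) u w
  dist-step e (k , k≤r , p) = suc k , s≤s k≤r , step e p

record Near {V : Set} (G : Graph V) {p : ℕ} (r : ℕ) (ρ : Vec V p) (u : V) : Set where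
  constructor _,_
  field
    root     : Fin p
    distance : Dist≤ G r (lookup ρ root) u

module _ {V : Set} {G : Graph V} {p : ℕ} {ρ : Vec V p} where

  near-mono : ∀ {r s u} → r ℕ.≤ s → Near G r ρ u → Near G s ρ u
  near-mono r≤s (i , δ) = i , dist-mono r≤s δ

  near-trans : ∀ {r s u v} → Near G r ρ u → Dist≤ G s u v → Near G (r ℕ.+ s) ρ v
  near-trans (i , δ) ε = i , dist-trans δ ε

module _ {V W : Set} {G : Graph V} {H : Graph W} where
  private
    module G = Graph G
    module H = Graph H

  -- A walk of length `k` from `u` stays within distance `k` of `u`, so edges need to be preserved
  -- only there. This matters because a local isomorphism is uncontrolled farther out.
  walk-map : (f : V → W) → ∀ {k u v} →
    (∀ {x y} → Dist≤ G k u x → Dist≤ G k u y → x G.~ y → f x H.~ f y) →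
    Walk G k u v → Walk H k (f u) (f v)
  walk-map f mono done       = done
  walk-map f mono (step e p) = step (mono dist-refl (1 , s≤s z≤n , step e done) e)
    (walk-map f (λ δ ε → mono (dist-step e δ) (dist-step e ε)) p)

  dist-map : (f : V → W) → ∀ {r u v} →
    (∀ {x y} → Dist≤ G r u x → Dist≤ G r u y → x G.~ y → f x H.~ f y) →
    Dist≤ G r u v → Dist≤ H r (f u) (f v)
  dist-map f mono (k , k≤r , p) =
    k , k≤r , walk-map f (λ δ ε → mono (dist-mono k≤r δ) (dist-mono k≤r ε)) p

-- Isomorphisms between the r-neighbourhoods of two tuples; the values of the
-- maps outside the neighbourhoods are irrelevant.
record LocalIso {V W : Set} (G : Graph V) (H : Graph W) (r : ℕ) {p : ℕ}
                (ρ : Vec V p) (σ : Vec W p) : Set where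
  private
    module G = Graph G
    module H = Graph H
  field
    to        : V → W
    from      : W → V
    to-root   : ∀ i → to (lookup ρ i) ≡ lookup σ i
    from-root : ∀ i → from (lookup σ i) ≡ lookup ρ i
    from∘to   : ∀ {u} → Near G r ρ u → from (to u) ≡ u
    to∘from   : ∀ {u} → Near H r σ u → to (from u) ≡ u
    to-adj    : ∀ {u v} → Near G r ρ u → Near G r ρ v → u G.~ v → to u H.~ to v
    from-adj  : ∀ {u v} → Near H r σ u → Near H r σ v → u H.~ v → from u G.~ from v

  to-near : ∀ {s u} → s ℕ.≤ r → Near G s ρ u → Near H s σ (to u)
  to-near s≤r (i , δ) = i , subst (λ w → Dist≤ H _ w _) (to-root i)
    (dist-map to (λ δ ε → to-adj (i , dist-mono s≤r δ) (i , dist-mono s≤r ε)) δ)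

LocalIso-sym : ∀ {V W : Set} {G : Graph V} {H : Graph W} {r p} {ρ : Vec V p} {σ : Vec W p} →
  LocalIso G H r ρ σ → LocalIso H G r σ ρ
LocalIso-sym I = record
  { to = from ; from = to ; to-root = from-root ; from-root = to-root
  ; from∘to = to∘from ; to∘from = from∘to ; to-adj = from-adj ; from-adj = to-adj }
  where open LocalIso I

module _ {V W : Set} {G : Graph V} {H : Graph W} where

  LocalIso-trans : ∀ {X : Set} {K : Graph X} {r p} {ρ : Vec V p} {σ : Vec W p} {τ : Vec X p} →
    LocalIso G H r ρ σ → LocalIso H K r σ τ → LocalIso G K r ρ τ
  LocalIso-trans I J = record
    { to        = J.to ∘ I.to
    ; from      = I.from ∘ J.from
    ; to-root   = λ i → trans (cong J.to (I.to-root i)) (J.to-root i)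
    ; from-root = λ i → trans (cong I.from (J.from-root i)) (I.from-root i)
    ; from∘to   = λ δ → trans (cong I.from (J.from∘to (I.to-near ℕ.≤-refl δ))) (I.from∘to δ)
    ; to∘from   = λ δ → trans (cong J.to (I.to∘from (J⁻.to-near ℕ.≤-refl δ))) (J.to∘from δ)
    ; to-adj    = λ δ ε e → J.to-adj (I.to-near ℕ.≤-refl δ) (I.to-near ℕ.≤-refl ε) (I.to-adj δ ε e)
    ; from-adj  = λ δ ε e → I.from-adj (J⁻.to-near ℕ.≤-refl δ) (J⁻.to-near ℕ.≤-refl ε) (J.from-adj δ ε e)
    }
    where
    module I = LocalIso I
    module J = LocalIso J
    module J⁻ = LocalIso (LocalIso-sym J)

  restrict : ∀ {r R p} {ρ : Vec V p} {σ : Vec W p} → r ℕ.≤ R →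
    LocalIso G H R ρ σ → LocalIso G H r ρ σ
  restrict r≤R I = record
    { to = to ; from = from ; to-root = to-root ; from-root = from-root
    ; from∘to  = λ δ → from∘to (near-mono r≤R δ)
    ; to∘from  = λ δ → to∘from (near-mono r≤R δ)
    ; to-adj   = λ δ ε → to-adj (near-mono r≤R δ) (near-mono r≤R ε)
    ; from-adj = λ δ ε → from-adj (near-mono r≤R δ) (near-mono r≤R ε)
    }
    where open LocalIso I

  LocalIso-head : ∀ {r p a b} {ρ : Vec V p} {σ : Vec W p} →
    LocalIso G H r (a ∷ ρ) (b ∷ σ) → LocalIso G H r (a ∷ []) (b ∷ [])
  LocalIso-head I = record
    { to = to ; from = from
    ; to-root   = λ { zero → to-root zero }
    ; from-root = λ { zero → from-root zero }
    ; from∘to   = λ δ → from∘to (widen δ)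
    ; to∘from   = λ δ → to∘from (widen δ)
    ; to-adj    = λ δ ε → to-adj (widen δ) (widen ε)
    ; from-adj  = λ δ ε → from-adj (widen δ) (widen ε)
    }
    where
    open LocalIso I
    widen : ∀ {X : Set} {K : Graph X} {r p a} {ρ : Vec X p} {u} →
            Near K r (a ∷ []) u → Near K r (a ∷ ρ) u
    widen (zero , δ) = zero , δ

  -- The `r`-ball of `a` lies within `s + r` of `ρ`, where the given maps already form an
  -- isomorphism, so the same maps serve for the longer tuples.
  extend-near : ∀ {r s R p a} {ρ : Vec V p} {σ : Vec W p} → s ℕ.+ r ℕ.≤ R →
    (I : LocalIso G H R ρ σ) → Near G s ρ a →
    LocalIso G H r (a ∷ ρ) (LocalIso.to I a ∷ σ)
  extend-near {r} {s} {R} s+r≤R I a-near = record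
    { to = to ; from = from
    ; to-root   = λ { zero → refl ; (suc i) → to-root i }
    ; from-root = λ { zero → from∘to (near-mono s≤R a-near) ; (suc i) → from-root i }
    ; from∘to   = λ δ → from∘to (absorb a-near δ)
    ; to∘from   = λ δ → to∘from (absorb b-near δ)
    ; to-adj    = λ δ ε → to-adj (absorb a-near δ) (absorb a-near ε)
    ; from-adj  = λ δ ε → from-adj (absorb b-near δ) (absorb b-near ε)
    }
    where
    open LocalIso I
    s≤R = ℕ.≤-trans (ℕ.m≤m+n s r) s+r≤R
    b-near = to-near s≤R a-near

    absorb : ∀ {X : Set} {K : Graph X} {p a} {ρ : Vec X p} {u} →
             Near K s ρ a → Near K r (a ∷ ρ) u → Near K R ρ u
    absorb near (zero  , δ) = near-mono s+r≤R (near-trans near δ)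
    absorb near (suc i , δ) = i , dist-mono (ℕ.≤-trans (ℕ.m≤n+m r s) s+r≤R) δ

-- Neighbourhoods at distance at least 2 are disjoint and not joined by an edge,
-- so isomorphisms between them can be glued.
module Glue {G H : FiniteGraph} {r p : ℕ} {a : Vertex G} {b : Vertex H}
            {ρ : Vec (Vertex G) p} {σ : Vec (Vertex H) p}
            (I₀ : LocalIso (graph G) (graph H) r (a ∷ []) (b ∷ []))
            (I : LocalIso (graph G) (graph H) r ρ σ)
            (a-far : ¬ Near (graph G) (suc (r ℕ.+ r)) ρ a) where
  open FiniteGraph G using (_~_; ~-sym)
  private
    module I₀ = LocalIso I₀
    module I  = LocalIso I

  glue : Vertex G → Vertex H
  glue u with dist≤? G r a u
  ... | yes _ = I₀.to u
  ... | no  _ = I.to u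

  -- Such an edge would give a walk of length at most `r + (1 + r)` from `ρ` to `a`. The edge
  -- accounts for the successor in the distance required of `a`; disjointness alone would ask for
  -- `r + r`.
  not-adjacent : ∀ {u v} → Dist≤ (graph G) r a u → Near (graph G) r ρ v → ¬ (u ~ v)
  not-adjacent {u} δ (i , ε) e = a-far (i , subst (λ k → Dist≤ (graph G) k (lookup ρ i) a)
    (ℕ.+-suc r r) (dist-trans ε (dist-step (~-sym e) (dist-sym δ))))

  disjoint : ∀ {u} → Dist≤ (graph G) r a u → ¬ Near (graph G) r ρ u
  disjoint δ (i , ε) = a-far (i , dist-mono (ℕ.n≤1+n _) (dist-trans ε (dist-sym δ)))

  glue-head : ∀ {u} → Dist≤ (graph G) r a u → glue u ≡ I₀.to u
  glue-head {u} δ with dist≤? G r a u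
  ... | yes _ = refl
  ... | no ¬δ = contradiction δ ¬δ

  glue-tail : ∀ {u} → Near (graph G) r ρ u → glue u ≡ I.to u
  glue-tail {u} ν with dist≤? G r a u
  ... | yes δ = contradiction ν (disjoint δ)
  ... | no _  = refl

  glue-root : ∀ i → glue (lookup (a ∷ ρ) i) ≡ lookup (b ∷ σ) i
  glue-root zero    = trans (glue-head dist-refl) (I₀.to-root zero)
  glue-root (suc i) = trans (glue-tail (i , dist-refl)) (I.to-root i)

  glue-adj : ∀ {u v} → Near (graph G) r (a ∷ ρ) u → Near (graph G) r (a ∷ ρ) v → u ~ v →
             FiniteGraph._~_ H (glue u) (glue v)
  glue-adj (zero , δ) (zero , ε) e = subst₂ (FiniteGraph._~_ H) (sym (glue-head δ)) (sym (glue-head ε))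
    (I₀.to-adj (zero , δ) (zero , ε) e)
  glue-adj (zero , δ) (suc j , ε) e = contradiction e (not-adjacent δ (j , ε))
  glue-adj (suc i , δ) (zero , ε) e = contradiction (~-sym e) (not-adjacent ε (i , δ))
  glue-adj (suc i , δ) (suc j , ε) e = subst₂ (FiniteGraph._~_ H)
    (sym (glue-tail (i , δ))) (sym (glue-tail (j , ε)))
    (I.to-adj (i , δ) (j , ε) e)

module _ {G H : FiniteGraph} {r p : ℕ} {a : Vertex G} {b : Vertex H}
         {ρ : Vec (Vertex G) p} {σ : Vec (Vertex H) p} where

  -- Each isomorphism maps its piece onto the corresponding piece, so the backward map takes the
  -- same branch as the forward one. Exchanging `G` and `H` yields the other inverse law of
  -- `extend-far`.
  glue-inverse : (I₀ : LocalIso (graph G) (graph H) r (a ∷ []) (b ∷ []))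
    (I : LocalIso (graph G) (graph H) r ρ σ)
    (a-far : ¬ Near (graph G) (suc (r ℕ.+ r)) ρ a)
    (b-far : ¬ Near (graph H) (suc (r ℕ.+ r)) σ b) →
    ∀ {u} → Near (graph G) r (a ∷ ρ) u →
    Glue.glue {H} {G} (LocalIso-sym I₀) (LocalIso-sym I) b-far (Glue.glue {G} {H} I₀ I a-far u) ≡ u
  glue-inverse I₀ I a-far b-far {u} = λ where
      (zero , δ) → trans (cong Bwd.glue (Fwd.glue-head δ))
        (trans (Bwd.glue-head (at-b (I₀.to-near ℕ.≤-refl (zero , δ)))) (I₀.from∘to (zero , δ)))
      (suc i , δ) → trans (cong Bwd.glue (Fwd.glue-tail (i , δ)))
        (trans (Bwd.glue-tail (I.to-near ℕ.≤-refl (i , δ))) (I.from∘to (i , δ)))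
    where
    module I₀ = LocalIso I₀
    module I  = LocalIso I
    module Fwd = Glue {G} {H} I₀ I a-far
    module Bwd = Glue {H} {G} (LocalIso-sym I₀) (LocalIso-sym I) b-far
    at-b : ∀ {w} → Near (graph H) r (b ∷ []) w → Dist≤ (graph H) r b w
    at-b (zero , δ) = δ

extend-far : ∀ {G H : FiniteGraph} {r p} {a : Vertex G} {b : Vertex H}
  {ρ : Vec (Vertex G) p} {σ : Vec (Vertex H) p} →
  LocalIso (graph G) (graph H) r (a ∷ []) (b ∷ []) →
  LocalIso (graph G) (graph H) r ρ σ →
  ¬ Near (graph G) (suc (r ℕ.+ r)) ρ a →
  ¬ Near (graph H) (suc (r ℕ.+ r)) σ b →
  LocalIso (graph G) (graph H) r (a ∷ ρ) (b ∷ σ)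
extend-far {G} {H} I₀ I a-far b-far = record
  { to        = Fwd.glue
  ; from      = Bwd.glue
  ; to-root   = Fwd.glue-root
  ; from-root = Bwd.glue-root
  ; from∘to   = glue-inverse {G} {H} I₀ I a-far b-far
  ; to∘from   = glue-inverse {H} {G} (LocalIso-sym I₀) (LocalIso-sym I) b-far a-far
  ; to-adj    = Fwd.glue-adj
  ; from-adj  = Bwd.glue-adj
  }
  where
  module Fwd = Glue {G} {H} I₀ I a-far
  module Bwd = Glue {H} {G} (LocalIso-sym I₀) (LocalIso-sym I) b-far

-- Counting the vertices near a tuple

near? : ∀ (G : FiniteGraph) {p} r (ρ : Vec (Vertex G) p) u → Dec (Near (graph G) r ρ u)
near? G r ρ u = map′ (λ (i , δ) → i , δ) (λ (i , δ) → i , δ)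
  (Fin.any? λ i → dist≤? G r (lookup ρ i) u)

length-concatMap≤ : {A B : Set} {f : A → List B} {b : ℕ} (xs : List A) →
  (∀ x → length (f x) ℕ.≤ b) → length (concatMap f xs) ℕ.≤ length xs ℕ.* b
length-concatMap≤ []       f≤b = z≤n
length-concatMap≤ {f = f} (x ∷ xs) f≤b = ℕ.≤-trans (ℕ.≤-reflexive (length-++ (f x)))
  (ℕ.+-mono-≤ (f≤b x) (length-concatMap≤ xs f≤b))

ballSize : ℕ → ℕ → ℕ
ballSize d zero    = 1
ballSize d (suc r) = suc (d ℕ.* ballSize d r)

module _ (G : FiniteGraph) where
  open FiniteGraph G using (_~?_)

  -- The list has one entry for each walk of length at most `r` from `v`, namely its end.
  -- Repetitions are harmless for an upper bound on the size of the ball.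
  ballList : ℕ → Vertex G → List (Vertex G)
  ballList zero    v = v ∷ []
  ballList (suc r) v = v ∷ concatMap (ballList r) (filter (v ~?_) (allFin (order G)))

  ∈-ballList : ∀ {r v u} → Dist≤ (graph G) r v u → u ∈ ballList r v
  ∈-ballList {zero}  (_ , z≤n     , done)     = here refl
  ∈-ballList {suc r} (_ , _       , done)     = here refl
  ∈-ballList {suc r} {v} (_ , s≤s k≤r , step e p) = there (∈-concatMap⁺ (ballList r)
    (lose (∈-filter⁺ (v ~?_) (∈-allFin _) e) (∈-ballList (_ , k≤r , p))))

  module _ {d : ℕ} (deg≤d : MaxDegree≤ d G) where

    length-ballList≤ : ∀ r v → length (ballList r v) ℕ.≤ ballSize d r
    length-ballList≤ zero    v = ℕ.≤-refl
    length-ballList≤ (suc r) v = s≤s (ℕ.≤-trans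
      (length-concatMap≤ (filter (v ~?_) (allFin (order G))) (length-ballList≤ r))
      (ℕ.*-monoˡ-≤ _ (deg≤d v)))

    -- The bound depends on `d`, `p` and `r` but not on the graph. It limits the number of counting
    -- sentences to be considered and makes balls negligible as the order grows.
    near-length≤ : ∀ {p r} {ρ : Vec (Vertex G) p} {us} → Unique us →
      (∀ {u} → u ∈ us → Near (graph G) r ρ u) → length us ℕ.≤ p ℕ.* ballSize d r
    near-length≤ {p} {r} {ρ} {us} unique near = ℕ.≤-trans
      (Unique-⊆⇒length≤ unique us⊆)
      (ℕ.≤-trans (length-concatMap≤ roots (length-ballList≤ r))
        (ℕ.≤-reflexive (cong (ℕ._* ballSize d r) (length-tabulate (lookup ρ)))))
      where
      roots = List.tabulate (lookup ρ)
      us⊆ : us ⊆ concatMap (ballList r) roots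
      us⊆ u∈us with near u∈us
      ... | i , δ = ∈-concatMap⁺ (ballList r) (lose (∈-tabulate⁺ i) (∈-ballList δ))

-- Rooted isomorphisms of balls as local isomorphisms

BallIso : ℕ → (G : FiniteGraph) → Vertex G → (F : FiniteGraph) → Vertex F → Set
BallIso r G v F o = (ball (graph G) v r , centre (graph G) v r) ≅ (graph F , o)

Radius≤ : ℕ → (F : FiniteGraph) → Vertex F → Set
Radius≤ r F o = ∀ x → Dist≤ (graph F) r o x

module _ {r : ℕ} {G : FiniteGraph} {v : Vertex G} {F : FiniteGraph} {o : Vertex F} where
  private
    module G = FiniteGraph G
    module F = FiniteGraph F

  -- The membership proof inside a ball vertex is irrelevant; since bounded distance is decidable, a
  -- usable proof can be recomputed.
  ballDistance : (u : BallVertex (graph G) v r) → Dist≤ (graph G) r v (value u)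
  ballDistance (u , [ δ ]) = recompute (dist≤? G r v u) δ

  BallIso⇒LocalIso : BallIso r G v F o → LocalIso (graph G) (graph F) r (v ∷ []) (o ∷ [])
  BallIso⇒LocalIso I = record
    { to = to ; from = from
    ; to-root   = λ { zero → trans (to≡ dist-refl) I.root }
    ; from-root = λ { zero → from-o }
    ; from∘to   = λ { (zero , δ) → trans (cong from (to≡ δ)) (cong value (Bij.strictlyInverseʳ _)) }
    ; to∘from   = λ _ → to∘from _
    ; to-adj    = λ { (zero , δ) (zero , ε) e → subst₂ F._~_ (sym (to≡ δ)) (sym (to≡ ε))
                        (Equivalence.to (I.adjacency _ _) e) }
    ; from-adj  = λ {x} {y} _ _ e → Equivalence.from (I.adjacency (I.from x) (I.from y))
                    (subst₂ F._~_ (sym (Bij.strictlyInverseˡ x)) (sym (Bij.strictlyInverseˡ y)) e)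
    }
    where
    module I = _≅_ I
    module Bij = Inverse I.bijection

    to : G.Vertex → F.Vertex
    to u with dist≤? G r v u
    ... | yes δ = I.to (u , [ δ ])
    -- Outside the ball any value would do.
    ... | no  _ = o

    to≡ : ∀ {u} (δ : Dist≤ (graph G) r v u) → to u ≡ I.to (u , [ δ ])
    to≡ {u} δ with dist≤? G r v u
    ... | yes _ = refl
    ... | no ¬δ = contradiction δ ¬δ

    from : F.Vertex → G.Vertex
    from x = value (I.from x)

    to∘from : ∀ x → to (from x) ≡ x
    to∘from x = trans (to≡ (ballDistance (I.from x))) (Bij.strictlyInverseˡ x)

    from-o : from o ≡ v
    from-o = cong value (trans (cong I.from (sym I.root)) (Bij.strictlyInverseʳ (centre (graph G) v r)))

  -- Every `x` is the image of a ball vertex, whose walk from `v` is carried over to `F`. A local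
  -- isomorphism says nothing about `F` beyond radius `r`, so this bound has to accompany it when
  -- the rooted isomorphism is recovered.
  BallIso⇒Radius≤ : BallIso r G v F o → Radius≤ r F o
  BallIso⇒Radius≤ I x with L.to-near ℕ.≤-refl (zero , ballDistance (_≅_.from I x))
    where module L = LocalIso (BallIso⇒LocalIso I)
  ... | zero , δ = subst (Dist≤ (graph F) r o) (to∘from x) δ
    where
    module I = _≅_ I
    module Bij = Inverse I.bijection
    module L = LocalIso (BallIso⇒LocalIso I)
    to∘from : ∀ x → L.to (L.from x) ≡ x
    to∘from x with dist≤? G r v (L.from x)
    ... | yes δ = Bij.strictlyInverseˡ x
    ... | no ¬δ = contradiction (ballDistance (I.from x)) ¬δ

  LocalIso⇒BallIso : LocalIso (graph G) (graph F) r (v ∷ []) (o ∷ []) → Radius≤ r F o →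
    BallIso r G v F o
  LocalIso⇒BallIso I rad = record
    { bijection = mk↔ₛ′ (λ u → I.to (value u)) (λ x → I.from x , [ from-near x ])
        (λ x → I.to∘from (zero , rad x))
        (λ u → value-injective (I.from∘to (near u)))
    ; adjacency = λ x y → mk⇔ (I.to-adj (near x) (near y))
        (λ e → subst₂ G._~_ (I.from∘to (near x)) (I.from∘to (near y))
                 (I.from-adj (zero , rad _) (zero , rad _) e))
    ; root = I.to-root zero
    }
    where
    module I = LocalIso I
    near : (u : BallVertex (graph G) v r) → Near (graph G) r (v ∷ []) (value u)
    near u = zero , ballDistance u
    from-near : ∀ x → Dist≤ (graph G) r v (I.from x)
    from-near x with LocalIso.to-near (LocalIso-sym I) ℕ.≤-refl (zero , rad x)
    ... | zero , δ = δ

-- Finitely many rooted graphs represent all r-balls of maximum degree d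

Code : Set
Code = ∃ λ k → Vec (Vec Bool k) k × Fin k

-- Symmetrising by `∨` and excluding the diagonal turns every Boolean matrix into a graph, so codes
-- can be enumerated without side conditions.
codeGraph : Code → FiniteGraph
codeGraph (k , M , o) = record
  { order    = k
  ; nonEmpty = Fin.nonZeroIndex o
  ; graph    = record
    { _~_      = λ x y → x ≢ y × T (entry x y ∨ entry y x)
    ; ~-irrefl = λ x≡y (x≢y , _) → x≢y x≡y
    ; ~-sym    = λ {x} {y} (x≢y , t) → x≢y ∘ sym , subst T (∨-comm (entry x y) (entry y x)) t
    }
  ; _~?_     = λ x y → ¬? (x Fin.≟ y) ×-dec T? (entry x y ∨ entry y x)
  }
  where
  entry : Fin k → Fin k → Bool
  entry x y = lookup (lookup M x) y

codeRoot : (c : Code) → Vertex (codeGraph c)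
codeRoot (k , M , o) = o

-- A record rather than a synonym of `BallIso`, so that `G`, `v` and `c` can be read off from the
-- type.
record HasType (r : ℕ) (G : FiniteGraph) (v : Vertex G) (c : Code) : Set where
  constructor hasType
  field
    ballIso : BallIso r G v (codeGraph c) (codeRoot c)

hasType? : ∀ r G v c → Dec (HasType r G v c)
hasType? r G v c = map′ hasType HasType.ballIso (ball≅? G v r (codeGraph c) (codeRoot c))

HasType⇒LocalIso : ∀ {r G v c} → HasType r G v c →
  LocalIso (graph G) (graph (codeGraph c)) r (v ∷ []) (codeRoot c ∷ [])
HasType⇒LocalIso {G = G} {c = c} (hasType I) = BallIso⇒LocalIso {G = G} {F = codeGraph c} I

LocalIso⇒HasType : ∀ {r G v c} →
  LocalIso (graph G) (graph (codeGraph c)) r (v ∷ []) (codeRoot c ∷ []) →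
  Radius≤ r (codeGraph c) (codeRoot c) → HasType r G v c
LocalIso⇒HasType {G = G} {c = c} I rad = hasType (LocalIso⇒BallIso {G = G} {F = codeGraph c} I rad)

HasType-resp : ∀ {r G H v w c} → LocalIso (graph G) (graph H) r (v ∷ []) (w ∷ []) →
  HasType r G v c → HasType r H w c
HasType-resp {G = G} {c = c} I J@(hasType iso) =
  LocalIso⇒HasType (LocalIso-trans (LocalIso-sym I) (HasType⇒LocalIso J))
    (BallIso⇒Radius≤ {G = G} {F = codeGraph c} iso)

sameType⇒LocalIso : ∀ {r G H v w c} → HasType r G v c → HasType r H w c →
  LocalIso (graph G) (graph H) r (v ∷ []) (w ∷ [])
sameType⇒LocalIso I J = LocalIso-trans (HasType⇒LocalIso I) (LocalIso-sym (HasType⇒LocalIso J))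

vecs : {A : Set} → List A → ∀ n → List (Vec A n)
vecs xs zero    = [] ∷ []
vecs xs (suc n) = cartesianProductWith _∷_ xs (vecs xs n)

∈-vecs : {A : Set} {xs : List A} → (∀ x → x ∈ xs) → ∀ {n} (v : Vec A n) → v ∈ vecs xs n
∈-vecs x∈xs []      = here refl
∈-vecs x∈xs (x ∷ v) = ∈-cartesianProductWith⁺ _∷_ (x∈xs x) (∈-vecs x∈xs v)

bools : List Bool
bools = false ∷ true ∷ []

∈-bools : ∀ b → b ∈ bools
∈-bools false = here refl
∈-bools true  = there (here refl)

codesOfOrder : ℕ → List Code
codesOfOrder k = List.map (k ,_) (cartesianProduct (vecs (vecs bools k) k) (allFin k))

codes : ℕ → List Code
codes m = concatMap codesOfOrder (upTo (suc m))

∈-codes : ∀ {m} (c : Code) → proj₁ c ℕ.≤ m → c ∈ codes m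
∈-codes (k , M , o) k≤m = ∈-concatMap⁺ codesOfOrder (lose (∈-upTo⁺ (s≤s k≤m))
  (∈-map⁺ (k ,_) (∈-cartesianProduct⁺ (∈-vecs (∈-vecs ∈-bools) M) (∈-allFin o))))

-- These conditions make the code a legitimate test graph for BS-convergence: a radius bound implies
-- connectedness.
IsType : ℕ → ℕ → Code → Set
IsType d r c = Radius≤ r (codeGraph c) (codeRoot c) × MaxDegree≤ d (codeGraph c)

isType? : ∀ d r c → Dec (IsType d r c)
isType? d r c = Fin.all? (λ x → dist≤? (codeGraph c) r (codeRoot c) x)
  ×-dec Fin.all? (λ x → degree (codeGraph c) x ℕ.≤? d)

module _ {A : Set} {R : A → A → Set} (R? : ∀ x y → Dec (R x y)) where

  -- Applied to codes, this keeps one representative of each isomorphism class. Otherwise a vertex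
  -- could have several types, and the frequency of a chosen type could fall short of the density of
  -- its ball.
  dedupe : List A → List A
  dedupe []       = []
  dedupe (x ∷ xs) with any? (R? x) (dedupe xs)
  ... | yes _ = dedupe xs
  ... | no  _ = x ∷ dedupe xs

  dedupe-Any : {P : A → Set} → (∀ {x y} → R x y → P x → P y) →
    ∀ {xs} → Any P xs → Any P (dedupe xs)
  dedupe-Any resp {x ∷ xs} p with any? (R? x) (dedupe xs)
  dedupe-Any resp (here px) | yes a = Any.map (λ rxy → resp rxy px) a
  dedupe-Any resp (there p) | yes a = dedupe-Any resp p
  dedupe-Any resp (here px) | no _  = here px
  dedupe-Any resp (there p) | no _  = there (dedupe-Any resp p)

  dedupe-All : {P : A → Set} → ∀ {xs} → All P xs → All P (dedupe xs)
  dedupe-All {xs = []}     []         = []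
  dedupe-All {xs = x ∷ xs} (px ∷ pxs) with any? (R? x) (dedupe xs)
  ... | yes _ = dedupe-All pxs
  ... | no  _ = px ∷ dedupe-All pxs

  dedupe-AllPairs : ∀ xs → AllPairs (λ x y → ¬ R x y) (dedupe xs)
  dedupe-AllPairs []       = []
  dedupe-AllPairs (x ∷ xs) with any? (R? x) (dedupe xs)
  ... | yes _ = dedupe-AllPairs xs
  ... | no ¬a = All.¬Any⇒All¬ _ ¬a ∷ dedupe-AllPairs xs

-- `AllPairs` speaks of pairs in list order only and `R` is not assumed symmetric, hence the
-- relation is supplied in both directions.
AllPairs-¬⇒≡ : {A : Set} {R : A → A → Set} {xs : List A} → AllPairs (λ x y → ¬ R x y) xs →
  ∀ i j → R (List.lookup xs i) (List.lookup xs j) → R (List.lookup xs j) (List.lookup xs i) → i ≡ j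
AllPairs-¬⇒≡ (px ∷ ps) zero    zero    r s = refl
AllPairs-¬⇒≡ (px ∷ ps) zero    (suc j) r s = contradiction r (All.lookup px (∈-lookup j))
AllPairs-¬⇒≡ (px ∷ ps) (suc i) zero    r s = contradiction s (All.lookup px (∈-lookup i))
AllPairs-¬⇒≡ (px ∷ ps) (suc i) (suc j) r s = cong suc (AllPairs-¬⇒≡ ps i j r s)

does⇒ : {A : Set} (a? : Dec A) → T (does a?) → A
does⇒ (yes a) _ = a

-- The code of a given ball, its vertices numbered by their positions in a list

module BallCode (G : FiniteGraph) {d : ℕ} (deg≤d : MaxDegree≤ d G) (r : ℕ) (v : Vertex G) where
  open FiniteGraph G using (_~_; _~?_; ~-irrefl; ~-sym)

  us : List (Vertex G)
  us = filter (dist≤? G r v) (allFin (order G))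

  us-unique : Unique us
  us-unique = Unique.filter⁺ (dist≤? G r v) (Unique.allFin⁺ (order G))

  vertex : Fin (length us) → Vertex G
  vertex = List.lookup us

  vertex-near : ∀ x → Dist≤ (graph G) r v (vertex x)
  vertex-near x = proj₂ (∈-filter⁻ (dist≤? G r v) {xs = allFin (order G)} (∈-lookup x))

  ∈-us : ∀ {u} → Dist≤ (graph G) r v u → u ∈ us
  ∈-us δ = ∈-filter⁺ (dist≤? G r v) (∈-allFin _) δ

  o : Fin (length us)
  o = index (∈-us dist-refl)

  code : Code
  code = length us , tabulate (λ x → tabulate λ y → does (vertex x ~? vertex y)) , o

  F : FiniteGraph
  F = codeGraph code
  private module F = FiniteGraph F

  entry≡ : ∀ x y → lookup (lookup (proj₁ (proj₂ code)) x) y ≡ does (vertex x ~? vertex y)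
  entry≡ x y = trans (cong (λ row → lookup row y) (lookup∘tabulate _ x)) (lookup∘tabulate _ y)

  adj⁺ : ∀ {x y} → x F.~ y → vertex x ~ vertex y
  adj⁺ {x} {y} (_ , t) =
    [ (λ s → does⇒ (vertex x ~? vertex y) (subst T (entry≡ x y) s))
    , (λ s → ~-sym (does⇒ (vertex y ~? vertex x) (subst T (entry≡ y x) s))) ]′
    (Equivalence.to T-∨ t)

  adj⁻ : ∀ {x y} → vertex x ~ vertex y → x F.~ y
  adj⁻ {x} {y} e = (λ x≡y → ~-irrefl (cong vertex x≡y) e) ,
    Equivalence.from T-∨ (inj₁ (subst T (sym (trans (entry≡ x y) (dec-true (vertex x ~? vertex y) e))) tt))

  position : Vertex G → Vertex F
  position u with dist≤? G r v u
  ... | yes δ = index (∈-us δ)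
  ... | no  _ = o

  vertex∘position : ∀ {u} → Dist≤ (graph G) r v u → vertex (position u) ≡ u
  vertex∘position {u} δ with dist≤? G r v u
  ... | yes δ′ = sym (lookup-index (∈-us δ′))
  ... | no ¬δ  = contradiction δ ¬δ

  vertex-o : vertex o ≡ v
  vertex-o = sym (lookup-index (∈-us dist-refl))

  vertex-injective : ∀ {x y} → vertex x ≡ vertex y → x ≡ y
  vertex-injective = lookup-injective us-unique _ _

  position∘vertex : ∀ x → position (vertex x) ≡ x
  position∘vertex x = vertex-injective (vertex∘position (vertex-near x))

  localIso : LocalIso (graph G) (graph F) r (v ∷ []) (o ∷ [])
  localIso = record
    { to = position ; from = vertex
    ; to-root   = λ { zero → vertex-injective (trans (vertex∘position dist-refl) (sym vertex-o)) }
    ; from-root = λ { zero → vertex-o }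
    ; from∘to   = λ { (zero , δ) → vertex∘position δ }
    ; to∘from   = λ _ → position∘vertex _
    ; to-adj    = λ { (zero , δ) (zero , ε) e →
        adj⁻ (subst₂ _~_ (sym (vertex∘position δ)) (sym (vertex∘position ε)) e) }
    ; from-adj  = λ _ _ → adj⁺
    }

  radius : Radius≤ r F o
  radius x with LocalIso.to-near localIso ℕ.≤-refl (zero , vertex-near x)
  ... | zero , δ = subst (Dist≤ (graph F) r o) (position∘vertex x) δ

  code-hasType : HasType r G v code
  code-hasType = LocalIso⇒HasType localIso radius

  maxDegree : MaxDegree≤ d F
  maxDegree x = begin
    length neighbours                   ≡⟨ length-map vertex neighbours ⟨
    length (List.map vertex neighbours) ≤⟨ Unique-⊆⇒length≤
                                             (Unique.map⁺ vertex-injective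
                                               (Unique.filter⁺ (x F.~?_) (Unique.allFin⁺ _)))
                                             neighbours⊆ ⟩
    degree G (vertex x)                 ≤⟨ deg≤d (vertex x) ⟩
    d                                   ∎
    where
    open ℕ.≤-Reasoning
    neighbours = filter (x F.~?_) (allFin (order F))
    neighbours⊆ : List.map vertex neighbours ⊆ filter (vertex x ~?_) (allFin (order G))
    neighbours⊆ u∈ with ∈-map⁻ vertex u∈
    ... | y , y∈ , refl = ∈-filter⁺ (vertex x ~?_) (∈-allFin _)
      (adj⁺ (proj₂ (∈-filter⁻ (x F.~?_) {xs = allFin (order F)} y∈)))

  size : length us ℕ.≤ ballSize d r
  size = ℕ.≤-trans (near-length≤ G deg≤d {p = 1} {ρ = v ∷ []} us-unique
           (λ u∈ → zero , proj₂ (∈-filter⁻ (dist≤? G r v) {xs = allFin (order G)} u∈)))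
    (ℕ.≤-reflexive (ℕ.*-identityˡ _))

  code∈ : code ∈ filter (isType? d r) (codes (ballSize d r))
  code∈ = ∈-filter⁺ (isType? d r) (∈-codes code size) (radius , maxDegree)

module Types (d r : ℕ) where
  private
    codeIso? : ∀ c c′ → Dec (HasType r (codeGraph c) (codeRoot c) c′)
    codeIso? c c′ = hasType? r (codeGraph c) (codeRoot c) c′

    candidates : List Code
    candidates = filter (isType? d r) (codes (ballSize d r))

  abstract
    types : List Code
    types = dedupe codeIso? candidates

  Type : Set
  Type = Fin (length types)

  code : Type → Code
  code = List.lookup types

  abstract
    code-isType : ∀ i → IsType d r (code i)
    code-isType i = All.lookup
      (dedupe-All codeIso? (All.tabulate λ c∈ → proj₂ (∈-filter⁻ (isType? d r) {xs = codes (ballSize d r)} c∈)))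
      (∈-lookup i)

    -- The codes of two types of one vertex are isomorphic to each other through its ball, which
    -- `dedupe` has excluded for distinct positions.
    type-unique : ∀ G {v i j} → HasType r G v (code i) → HasType r G v (code j) → i ≡ j
    type-unique G {i = i} {j} I J = AllPairs-¬⇒≡ (dedupe-AllPairs codeIso? candidates) i j
      (HasType-resp (HasType⇒LocalIso I) J) (HasType-resp (HasType⇒LocalIso J) I)

    typed : ∀ G → MaxDegree≤ d G → ∀ v → ∃ λ i → HasType r G v (code i)
    typed G deg≤d v = index any , lookup-index any
      where
      any : Any (HasType r G v) types
      any = dedupe-Any codeIso? (λ R I → HasType-resp (LocalIso-sym (HasType⇒LocalIso I)) R)
        (lose (BallCode.code∈ G deg≤d r v) (BallCode.code-hasType G deg≤d r v))

-- Finite conjunctions, quantifier blocks and bounded distance in first-order logic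

∀-⇔ : {A : Set} {P Q : A → Set} → (∀ x → P x ⇔ Q x) → (∀ x → P x) ⇔ (∀ x → Q x)
∀-⇔ e = mk⇔ (λ p x → Equivalence.to (e x) (p x)) (λ q x → Equivalence.from (e x) (q x))

∃-⇔ : {A : Set} {P Q : A → Set} → (∀ x → P x ⇔ Q x) → ∃ P ⇔ ∃ Q
∃-⇔ e = mk⇔ (λ (x , p) → x , Equivalence.to (e x) p) (λ (x , q) → x , Equivalence.from (e x) q)

≡-⇔ : {A : Set} {a b c d : A} → a ≡ c → b ≡ d → (a ≡ b) ⇔ (c ≡ d)
≡-⇔ refl refl = mk⇔ id id

-- The quantifier provides a variable to compare even when `p` is 0.
⊤′ : ∀ {p} → Formula p
⊤′ = ∀′ zero ≐ zero

⋀ : ∀ {p n} → (Fin n → Formula p) → Formula p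
⋀ {n = zero}  φ = ⊤′
⋀ {n = suc n} φ = φ zero ∧′ ⋀ (φ ∘ suc)

⋁ : ∀ {p n} → (Fin n → Formula p) → Formula p
⋁ {n = zero}  φ = ¬′ ⊤′
⋁ {n = suc n} φ = φ zero ∨′ ⋁ (φ ∘ suc)

-- `A` is decided when the formula is built, so the equivalence of `A` and `φ` can be expressed by
-- `φ` or its negation.
literal : ∀ {A : Set} {p} → Dec A → Formula p → Formula p
literal (yes _) φ = φ
literal (no _)  φ = ¬′ φ

exists : ∀ m {p} → Formula (m ℕ.+ p) → Formula p
exists zero    φ = φ
exists (suc m) φ = exists m (∃′ φ)

within : ∀ {p} → ℕ → Fin p → Fin p → Formula p
within zero    i j = i ≐ j
within (suc r) i j = i ≐ j ∨′ ∃′ (suc i adj zero ∧′ within r zero (suc j))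

module _ {V : Set} (G : Graph V) where
  open Graph G

  ⋀-⇔ : ∀ {p n} {ρ : Vec V p} (φ : Fin n → Formula p) {P : Fin n → Set} →
    (∀ i → (G ⊨ φ i [ ρ ]) ⇔ P i) → (G ⊨ ⋀ φ [ ρ ]) ⇔ (∀ i → P i)
  ⋀-⇔ {n = zero}  φ e = mk⇔ (λ _ ()) (λ _ _ → refl)
  ⋀-⇔ {n = suc n} φ e = mk⇔
    (λ { (p , ps) zero → Equivalence.to (e zero) p
       ; (p , ps) (suc i) → Equivalence.to (⋀-⇔ (φ ∘ suc) (e ∘ suc)) ps i })
    (λ p → Equivalence.from (e zero) (p zero) , Equivalence.from (⋀-⇔ (φ ∘ suc) (e ∘ suc)) (p ∘ suc))

  ⋁-⇔ : ∀ {p n} {ρ : Vec V p} (φ : Fin n → Formula p) {P : Fin n → Set} →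
    (∀ i → (G ⊨ φ i [ ρ ]) ⇔ P i) → (G ⊨ ⋁ φ [ ρ ]) ⇔ ∃ P
  ⋁-⇔ {n = zero}  φ e = mk⇔ (λ ¬⊤ → contradiction (λ _ → refl) ¬⊤) (λ ())
  ⋁-⇔ {n = suc n} φ e = mk⇔
    (λ { (inj₁ p) → zero , Equivalence.to (e zero) p
       ; (inj₂ p) → let (i , q) = Equivalence.to (⋁-⇔ (φ ∘ suc) (e ∘ suc)) p in suc i , q })
    (λ { (zero , p) → inj₁ (Equivalence.from (e zero) p)
       ; (suc i , p) → inj₂ (Equivalence.from (⋁-⇔ (φ ∘ suc) (e ∘ suc)) (i , p)) })

  literal-⇔ : ∀ {A B : Set} {p} {ρ : Vec V p} (A? : Dec A) (φ : Formula p) →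
    (G ⊨ φ [ ρ ]) ⇔ B → (G ⊨ literal A? φ [ ρ ]) ⇔ (A ⇔ B)
  literal-⇔ (yes a) φ e = mk⇔ (λ s → mk⇔ (λ _ → Equivalence.to e s) (λ _ → a))
    (λ a⇔b → Equivalence.from e (Equivalence.to a⇔b a))
  literal-⇔ (no ¬a) φ e = mk⇔
    (λ ¬s → mk⇔ (λ a → contradiction a ¬a) (λ b → contradiction (Equivalence.from e b) ¬s))
    (λ a⇔b s → ¬a (Equivalence.from a⇔b (Equivalence.to e s)))

  exists-⇔ : ∀ m {p} {ρ : Vec V p} (φ : Formula (m ℕ.+ p)) →
    (G ⊨ exists m φ [ ρ ]) ⇔ (∃ λ (e : Vec V m) → G ⊨ φ [ e ++ ρ ])
  exists-⇔ zero    φ = mk⇔ ([] ,_) (λ { ([] , s) → s })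
  exists-⇔ (suc m) φ = mk⇔
    (λ s → let (e , v , t) = Equivalence.to (exists-⇔ m (∃′ φ)) s in v ∷ e , t)
    (λ { (v ∷ e , t) → Equivalence.from (exists-⇔ m (∃′ φ)) (e , v , t) })

  dist-zero : ∀ {u v} → (u ≡ v) ⇔ Dist≤ G 0 u v
  dist-zero = mk⇔ (λ { refl → dist-refl }) (λ { (_ , z≤n , done) → refl })

  dist-suc : ∀ {r u v} → (u ≡ v ⊎ ∃ λ w → u ~ w × Dist≤ G r w v) ⇔ Dist≤ G (suc r) u v
  dist-suc = mk⇔
    (λ { (inj₁ refl)        → dist-refl
       ; (inj₂ (w , e , δ)) → dist-step e δ })
    (λ { (_ , _ , done)           → inj₁ refl
       ; (_ , s≤s k≤r , step e p) → inj₂ (_ , e , _ , k≤r , p) })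

  within-⇔ : ∀ r {p} {ρ : Vec V p} {i j u v} → lookup ρ i ≡ u → lookup ρ j ≡ v →
    (G ⊨ within r i j [ ρ ]) ⇔ Dist≤ G r u v
  within-⇔ zero            i≡ j≡ = dist-zero ⇔-∘ ≡-⇔ i≡ j≡
  within-⇔ (suc r) {ρ = ρ} {i} {j} i≡ j≡ = dist-suc ⇔-∘
    (≡-⇔ i≡ j≡ ⊎-⇔ ∃-⇔ λ w →
      mk⇔ (subst (_~ w) i≡) (subst (_~ w) (sym i≡)) ×-⇔
      within-⇔ r {ρ = w ∷ ρ} {zero} {suc j} refl j≡)

-- Describing a ball by a first-order formula

module _ (r : ℕ) (F : FiniteGraph) (o : Vertex F) where
  private
    m = order F
    module F = FiniteGraph F

  -- The block of `m` variables tabulates an isomorphism from `F` onto the ball of `x`. The clauses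
  -- express range, injectivity, surjectivity, adjacency and root; surjectivity is an implication
  -- written as a disjunction.
  hasBall : ∀ {p} → Fin p → Formula p
  hasBall {p} x = exists m
    ( ⋀ (λ i → within r x′ (e i))
    ∧′ ⋀ (λ i → ⋀ λ j → literal (i Fin.≟ j) (e i ≐ e j))
    ∧′ ∀′ (¬′ within r (suc x′) zero ∨′ ⋁ λ i → suc (e i) ≐ zero)
    ∧′ ⋀ (λ i → ⋀ λ j → literal (i F.~? j) (e i adj e j))
    ∧′ e o ≐ x′)
    where
    x′ : Fin (m ℕ.+ p)
    x′ = m ↑ʳ x
    e : Fin m → Fin (m ℕ.+ p)
    e i = i ↑ˡ p

  module _ (G : FiniteGraph) where
    private module G = FiniteGraph G

    -- Shaped clause by clause like `hasBall`, so that their equivalence is a mere congruence of the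
    -- connectives.
    IsTable : Vertex G → Vec (Vertex G) m → Set
    IsTable v e =
      (∀ i → Dist≤ (graph G) r v (lookup e i)) ×
      (∀ i j → (i ≡ j) ⇔ (lookup e i ≡ lookup e j)) ×
      (∀ u → (¬ Dist≤ (graph G) r v u) ⊎ (∃ λ i → lookup e i ≡ u)) ×
      (∀ i j → (i F.~ j) ⇔ (lookup e i G.~ lookup e j)) ×
      lookup e o ≡ v

    hasBall⇔table : ∀ {p} (ρ : Vec (Vertex G) p) x →
      (graph G ⊨ hasBall x [ ρ ]) ⇔ ∃ (IsTable (lookup ρ x))
    hasBall⇔table {p} ρ x = ∃-⇔ clauses ⇔-∘ exists-⇔ (graph G) m _
      where
      clauses : ∀ e → _ ⇔ IsTable (lookup ρ x) e
      clauses e =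
        ⋀-⇔ (graph G) _ (λ i → within-⇔ (graph G) r x≡ (e≡ i)) ×-⇔
        ⋀-⇔ (graph G) _ (λ i → ⋀-⇔ (graph G) _ λ j →
          literal-⇔ (graph G) (i Fin.≟ j) _ (≡-⇔ (e≡ i) (e≡ j))) ×-⇔
        ∀-⇔ (λ u → ¬-cong-⇔ (within-⇔ (graph G) r {ρ = u ∷ e ++ ρ} {suc (m ↑ʳ x)} {zero} x≡ refl) ⊎-⇔
          ⋁-⇔ (graph G) _ (λ i → ≡-⇔ (e≡ i) refl)) ×-⇔
        ⋀-⇔ (graph G) _ (λ i → ⋀-⇔ (graph G) _ λ j →
          literal-⇔ (graph G) (i F.~? j) _ (~-⇔ (e≡ i) (e≡ j))) ×-⇔
        ≡-⇔ (e≡ o) x≡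
        where
        x≡ : lookup (e ++ ρ) (m ↑ʳ x) ≡ lookup ρ x
        x≡ = lookup-++ʳ e ρ x
        e≡ : ∀ i → lookup (e ++ ρ) (i ↑ˡ p) ≡ lookup e i
        e≡ = lookup-++ˡ e ρ
        ~-⇔ : ∀ {a b c d} → a ≡ c → b ≡ d → (a G.~ b) ⇔ (c G.~ d)
        ~-⇔ refl refl = mk⇔ id id

    table⇒BallIso : ∀ {v} → ∃ (IsTable v) → BallIso r G v F o
    table⇒BallIso {v} (e , near , inj , surj , adj⇔ , root) = record
      { bijection = mk↔ₛ′ to from (λ x → inj⁻ (e∘to (from x))) (λ u → value-injective (e∘to u))
      ; adjacency = λ x y → mk⇔
          (λ x~y → Equivalence.from (adj⇔ _ _) (subst₂ G._~_ (sym (e∘to x)) (sym (e∘to y)) x~y))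
          (λ a → subst₂ G._~_ (e∘to x) (e∘to y) (Equivalence.to (adj⇔ _ _) a))
      ; root = inj⁻ (trans (e∘to (centre (graph G) v r)) (sym root))
      }
      where
      inj⁻ : ∀ {i j} → lookup e i ≡ lookup e j → i ≡ j
      inj⁻ = Equivalence.from (inj _ _)

      preimage : (u : BallVertex (graph G) v r) → ∃ λ i → lookup e i ≡ value u
      preimage u with surj (value u)
      ... | inj₁ ¬δ = contradiction (ballDistance {G = G} {F = F} {o = o} u) ¬δ
      ... | inj₂ i  = i

      to : BallVertex (graph G) v r → Vertex F
      to u = proj₁ (preimage u)

      e∘to : ∀ u → lookup e (to u) ≡ value u
      e∘to u = proj₂ (preimage u)

      from : Vertex F → BallVertex (graph G) v r
      from x = lookup e x , [ near x ]

    BallIso⇒table : ∀ {v} → BallIso r G v F o → ∃ (IsTable v)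
    BallIso⇒table {v} I = tabulate from
      , (λ x → subst (Dist≤ (graph G) r v) (sym (e≡ x)) (ballDistance {G = G} {F = F} {o = o} (I.from x)))
      , (λ x y → mk⇔ (cong (lookup (tabulate from)))
           (λ eq → from-injective (trans (sym (e≡ x)) (trans eq (e≡ y)))))
      , covered
      , (λ x y → mk⇔
           (λ a → subst₂ G._~_ (sym (e≡ x)) (sym (e≡ y)) (L.from-adj (zero , rad x) (zero , rad y) a))
           (λ a → subst₂ F._~_ (Bij.strictlyInverseˡ x) (Bij.strictlyInverseˡ y)
             (Equivalence.to (I.adjacency (I.from x) (I.from y)) (subst₂ G._~_ (e≡ x) (e≡ y) a))))
      , trans (e≡ o) (L.from-root zero)
      where
      module I = _≅_ I
      module Bij = Inverse I.bijection
      module L = LocalIso (BallIso⇒LocalIso {G = G} {F = F} I)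
      rad = BallIso⇒Radius≤ {G = G} {F = F} I

      from : Vertex F → Vertex G
      from x = value (I.from x)

      e≡ : ∀ x → lookup (tabulate from) x ≡ from x
      e≡ = lookup∘tabulate from

      from-injective : ∀ {x y} → from x ≡ from y → x ≡ y
      from-injective {x} {y} eq = trans (sym (Bij.strictlyInverseˡ x))
        (trans (cong I.to (value-injective eq)) (Bij.strictlyInverseˡ y))

      covered : ∀ u → (¬ Dist≤ (graph G) r v u) ⊎ (∃ λ i → lookup (tabulate from) i ≡ u)
      covered u with dist≤? G r v u
      ... | no ¬δ = inj₁ ¬δ
      ... | yes δ = inj₂ (I.to (u , [ δ ]) ,
                      trans (e≡ _) (cong value (Bij.strictlyInverseʳ (u , [ δ ]))))

    hasBall-⇔ : ∀ {p} (ρ : Vec (Vertex G) p) x →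
      (graph G ⊨ hasBall x [ ρ ]) ⇔ BallIso r G (lookup ρ x) F o
    hasBall-⇔ ρ x = mk⇔ table⇒BallIso BallIso⇒table ⇔-∘ hasBall⇔table ρ x

-- Counting sentences

atLeast : ℕ → (∀ {p} → Fin p → Formula p) → Sentence
atLeast k χ = exists k
  ( ⋀ (λ i → ⋀ λ j → literal (i Fin.≟ j) ((i ↑ˡ 0) ≐ (j ↑ˡ 0)))
  ∧′ ⋀ (λ i → χ (i ↑ˡ 0)))

module _ {V : Set} (G : Graph V) (χ : ∀ {p} → Fin p → Formula p) {P : V → Set}
         (χ-⇔ : ∀ {p} (ρ : Vec V p) x → (G ⊨ χ x [ ρ ]) ⇔ P (lookup ρ x)) where

  atLeast-⇔ : ∀ k → (G ⊨ atLeast k χ [ [] ]) ⇔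
    (∃ λ (e : Vec V k) → (∀ i j → (i ≡ j) ⇔ (lookup e i ≡ lookup e j)) × (∀ i → P (lookup e i)))
  atLeast-⇔ k = ∃-⇔ clauses ⇔-∘ exists-⇔ G k _
    where
    clauses : ∀ e → _ ⇔ _
    clauses e =
      ⋀-⇔ G _ (λ i → ⋀-⇔ G _ λ j → literal-⇔ G (i Fin.≟ j) _
        (≡-⇔ (lookup-++ˡ e [] i) (lookup-++ˡ e [] j))) ×-⇔
      ⋀-⇔ G _ (λ i → subst (λ u → (G ⊨ χ (i ↑ˡ 0) [ e ++ [] ]) ⇔ P u) (lookup-++ˡ e [] i) (χ-⇔ (e ++ []) (i ↑ˡ 0)))

  list⇒atLeast : ∀ {us} → Unique us → All P us → G ⊨ atLeast (length us) χ [ [] ]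
  list⇒atLeast {us} unique all = Equivalence.from (atLeast-⇔ (length us))
    ( tabulate (List.lookup us)
    , (λ i j → mk⇔ (cong (lookup (tabulate (List.lookup us)))) (λ eq → lookup-injective unique i j
        (trans (sym (lookup∘tabulate _ i)) (trans eq (lookup∘tabulate _ j)))))
    , (λ i → subst P (sym (lookup∘tabulate _ i)) (All.lookup all (∈-lookup i))))

  atLeast⇒list : ∀ {k} → G ⊨ atLeast k χ [ [] ] →
    ∃ λ us → Unique us × All P us × length us ≡ k
  atLeast⇒list {k} s =
    let (e , inj , all) = Equivalence.to (atLeast-⇔ k) s in
    List.tabulate (lookup e)
    , Unique.tabulate⁺ (Equivalence.from (inj _ _))
    , All.tabulate⁺ all
    , length-tabulate (lookup e)

typeFormula : ℕ → Code → ∀ {p} → Fin p → Formula p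
typeFormula r c = hasBall r (codeGraph c) (codeRoot c)

typeFormula-⇔ : ∀ r c G {p} (ρ : Vec (Vertex G) p) x →
  (graph G ⊨ typeFormula r c x [ ρ ]) ⇔ HasType r G (lookup ρ x) c
typeFormula-⇔ r c G ρ x =
  mk⇔ hasType HasType.ballIso ⇔-∘ hasBall-⇔ r (codeGraph c) (codeRoot c) G ρ x

Unique-map : {A B : Set} (f : A → B) {xs : List A} →
  (∀ {x y} → x ∈ xs → y ∈ xs → f x ≡ f y → x ≡ y) → Unique xs → Unique (List.map f xs)
Unique-map f inj []       = []
Unique-map f inj (px ∷ u) =
  All.map⁺ (All.tabulate λ y∈ eq → All.lookup px y∈ (inj (here refl) (there y∈) eq)) ∷
  Unique-map f (λ x∈ y∈ → inj (there x∈) (there y∈)) u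

-- Locality of first-order formulas along an elementarily convergent sequence

module Locality (d : ℕ) (𝒢 : ℕ → FiniteGraph) (deg≤d : ∀ n → MaxDegree≤ d (𝒢 n))
                (elementary : ElementarilyConvergent 𝒢) where

  G : ∀ n → Graph (Vertex (𝒢 n))
  G n = graph (𝒢 n)

  -- Whichever way a sentence settles, its truth passes between any two late graphs; this form hides
  -- which of the two cases occurred.
  Stable : Sentence → ℕ → Set
  Stable θ N = ∀ {m n} → N ℕ.≤ m → N ℕ.≤ n → G m ⊨ θ [ [] ] → G n ⊨ θ [ [] ]

  stable : ∀ θ → ∃ (Stable θ)
  stable θ with elementary θ
  ... | inj₁ (N , s)  = N , λ {m} {n} _ N≤n _ → s n N≤n
  ... | inj₂ (N , ¬s) = N , λ {m} N≤m _ s → contradiction s (¬s m N≤m)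

  all-stable : ∀ θs → ∃ λ N → ∀ {θ} → θ ∈ θs → Stable θ N
  all-stable []       = 0 , λ ()
  all-stable (θ ∷ θs) with stable θ | all-stable θs
  ... | M , S | N , T = M ⊔ N , λ where
    (here refl) M⊔N≤m M⊔N≤n → S (ℕ.≤-trans (ℕ.m≤m⊔n M N) M⊔N≤m) (ℕ.≤-trans (ℕ.m≤m⊔n M N) M⊔N≤n)
    (there θ∈)  M⊔N≤m M⊔N≤n → T θ∈ (ℕ.≤-trans (ℕ.m≤n⊔m M N) M⊔N≤m) (ℕ.≤-trans (ℕ.m≤n⊔m M N) M⊔N≤n)

  module Extension (p r : ℕ) where
    open Types d r using (types; code; typed)

    -- `s` is the distance beyond which `extend-far` applies, and `bound` limits the number of
    -- vertices within `s` of a `p`-tuple.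
    s bound : ℕ
    s     = suc (r ℕ.+ r)
    bound = p ℕ.* ballSize d s

    thresholds : List Sentence
    -- The counts run up to `1 + bound`: one vertex more than can lie near the tuple.
    thresholds = cartesianProductWith (λ k c → atLeast k (typeFormula r c)) (upTo (2 ℕ.+ bound)) types

    N : ℕ
    N = proj₁ (all-stable thresholds)

    module _ {m n} (N≤m : N ℕ.≤ m) (N≤n : N ℕ.≤ n) {ρ : Vec (Vertex (𝒢 m)) p} {σ : Vec (Vertex (𝒢 n)) p}
             (I : LocalIso (G m) (G n) (s ℕ.+ r) ρ σ) (a : Vertex (𝒢 m)) where
      private
        module I = LocalIso I
        I⁻ = LocalIso-sym I
        s≤R = ℕ.m≤m+n s r

        c : Code
        c = code (proj₁ (typed (𝒢 m) (deg≤d m) a))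

        a-type : HasType r (𝒢 m) a c
        a-type = proj₂ (typed (𝒢 m) (deg≤d m) a)

        alike? : ∀ u → Dec (Near (G m) s ρ u × HasType r (𝒢 m) u c)
        alike? u = near? (𝒢 m) s ρ u ×-dec hasType? r (𝒢 m) u c

        us : List (Vertex (𝒢 m))
        us = filter alike? (allFin _)

        us-unique : Unique us
        us-unique = Unique.filter⁺ alike? (Unique.allFin⁺ _)

        us-alike : ∀ {u} → u ∈ us → Near (G m) s ρ u × HasType r (𝒢 m) u c
        us-alike u∈ = proj₂ (∈-filter⁻ alike? {xs = allFin _} u∈)

        us-length : length us ℕ.≤ bound
        us-length = near-length≤ (𝒢 m) (deg≤d m) us-unique (proj₁ ∘ us-alike)

        -- The `r`-ball of `w` lies inside the domain of the inverse isomorphism, which therefore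
        -- preserves the type of `w`.
        from-alike : ∀ {w} → Near (G n) s σ w → HasType r (𝒢 n) w c → I.from w ∈ us
        from-alike near w-type = ∈-filter⁺ alike? (∈-allFin _)
          ( LocalIso.to-near I⁻ s≤R near
          , HasType-resp (LocalIso-head (extend-near ℕ.≤-refl I⁻ near)) w-type )

        -- Otherwise `I.from` would inject `ws` into `us`, the list of all vertices of type `c` near
        -- `ρ`, which is shorter by one.
        not-all-near : ∀ {ws} → Unique ws → All (λ w → HasType r (𝒢 n) w c) ws →
          length ws ≡ suc (length us) → ¬ (∀ {w} → w ∈ ws → Near (G n) s σ w)
        not-all-near {ws} unique types length≡ near = ℕ.1+n≰n (begin
          suc (length us)             ≡⟨ length≡ ⟨
          length ws                   ≡⟨ length-map I.from ws ⟨
          length (List.map I.from ws) ≤⟨ Unique-⊆⇒length≤ (Unique-map I.from inj unique) from⊆ ⟩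
          length us                   ∎)
          where
          open ℕ.≤-Reasoning
          to∘from : ∀ {w} → w ∈ ws → I.to (I.from w) ≡ w
          to∘from w∈ = I.to∘from (near-mono s≤R (near w∈))
          inj : ∀ {x y} → x ∈ ws → y ∈ ws → I.from x ≡ I.from y → x ≡ y
          inj x∈ y∈ eq = trans (sym (to∘from x∈)) (trans (cong I.to eq) (to∘from y∈))
          from⊆ : List.map I.from ws ⊆ us
          from⊆ u∈ = let (w , w∈ , eq) = ∈-map⁻ I.from u∈ in
            subst (_∈ us) (sym eq) (from-alike (near w∈) (All.lookup types w∈))

        θ : Sentence
        θ = atLeast (suc (length us)) (typeFormula r c)

        θ∈thresholds : θ ∈ thresholds
        θ∈thresholds = ∈-cartesianProductWith⁺ (λ k c → atLeast k (typeFormula r c))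
          {xs = upTo (2 ℕ.+ bound)} {ys = types}
          (∈-upTo⁺ (s≤s (s≤s us-length))) (∈-lookup (proj₁ (typed (𝒢 m) (deg≤d m) a)))

        -- Being far from `ρ`, the vertex `a` differs from all members of `us` and is one further
        -- vertex of type `c`.
        many : ¬ Near (G m) s ρ a → G m ⊨ θ [ [] ]
        many a-far = list⇒atLeast (G m) (typeFormula r c) {P = λ u → HasType r (𝒢 m) u c} (typeFormula-⇔ r c (𝒢 m))
          (All.tabulate (λ {u} u∈ a≡u → a-far (subst (Near (G m) s ρ) (sym a≡u) (proj₁ (us-alike u∈))))
            ∷ us-unique)
          (a-type ∷ All.tabulate (λ u∈ → proj₂ (us-alike u∈)))

        far-member : ∀ {ws} → Unique ws → All (λ w → HasType r (𝒢 n) w c) ws →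
          length ws ≡ suc (length us) → Dec (Any (λ w → ¬ Near (G n) s σ w) ws) →
          ∃ λ b → (¬ Near (G n) s σ b) × HasType r (𝒢 n) b c
        far-member unique types length≡ (yes far) =
          let (w , w∈ , w-far) = find far in w , w-far , All.lookup types w∈
        far-member {ws} unique types length≡ (no ¬far) = ⊥-elim (not-all-near unique types length≡
          λ {w} w∈ → decidable-stable (near? (𝒢 n) s σ w) (All.lookup (All.¬Any⇒All¬ ws ¬far) w∈))

        -- G m has more vertices of type c than lie near ρ, hence so has G n near σ.
        far-twin : ¬ Near (G m) s ρ a → ∃ λ b → (¬ Near (G n) s σ b) × HasType r (𝒢 n) b c
        far-twin a-far =
          let (ws , unique , types , length≡) =
                atLeast⇒list (G n) (typeFormula r c) {P = λ w → HasType r (𝒢 n) w c} (typeFormula-⇔ r c (𝒢 n))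
                  (proj₂ (all-stable thresholds) θ∈thresholds N≤m N≤n (many a-far))
          in far-member unique types length≡ (any? (λ w → ¬? (near? (𝒢 n) s σ w)) ws)

        extendBy : Dec (Near (G m) s ρ a) → ∃ λ b → LocalIso (G m) (G n) r (a ∷ ρ) (b ∷ σ)
        extendBy (yes near) = I.to a , extend-near ℕ.≤-refl I near
        extendBy (no far)   = let (b , b-far , b-type) = far-twin far in
          b , extend-far {𝒢 m} {𝒢 n} (sameType⇒LocalIso a-type b-type)
                (restrict (ℕ.m≤n+m r s) I) far b-far

      extension : ∃ λ b → LocalIso (G m) (G n) r (a ∷ ρ) (b ∷ σ)
      extension = extendBy (near? (𝒢 m) s ρ a)

  Local : ∀ {p} → Formula p → ℕ → ℕ → Set
  Local {p} φ r N = ∀ m n → N ℕ.≤ m → N ℕ.≤ n →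
    {ρ : Vec (Vertex (𝒢 m)) p} {σ : Vec (Vertex (𝒢 n)) p} →
    LocalIso (G m) (G n) r ρ σ → G m ⊨ φ [ ρ ] → G n ⊨ φ [ σ ]

  Local-mono : ∀ {p} {φ : Formula p} {r r′ N N′} → r ℕ.≤ r′ → N ℕ.≤ N′ → Local φ r N → Local φ r′ N′
  Local-mono r≤ N≤ L m n N≤m N≤n I = L m n (ℕ.≤-trans N≤ N≤m) (ℕ.≤-trans N≤ N≤n) (restrict r≤ I)

  -- `Local` treats the two graphs symmetrically. Negation therefore exchanges them, and for `∀′` a
  -- vertex of the second graph is pulled back by extending the inverse isomorphism.
  locality : ∀ {p} (φ : Formula p) → ∃ λ r → ∃ λ N → Local φ r N
  locality (i ≐ j) = 0 , 0 , λ m n _ _ I eq →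
    trans (sym (LocalIso.to-root I i)) (trans (cong (LocalIso.to I) eq) (LocalIso.to-root I j))
  locality (i adj j) = 0 , 0 , λ m n _ _ I e → subst₂ (Graph._~_ (G n))
    (LocalIso.to-root I i) (LocalIso.to-root I j)
    (LocalIso.to-adj I (i , dist-refl) (j , dist-refl) e)
  locality (¬′ φ) with locality φ
  ... | r , N , L = r , N , λ m n N≤m N≤n I ¬s s → ¬s (L n m N≤n N≤m (LocalIso-sym I) s)
  locality (φ ∧′ ψ) with locality φ | locality ψ
  ... | r , N , L | r′ , N′ , L′ = r ⊔ r′ , N ⊔ N′ , λ m n N≤m N≤n I (s , t) →
    Local-mono {φ = φ} (ℕ.m≤m⊔n r r′) (ℕ.m≤m⊔n N N′) L m n N≤m N≤n I s ,
    Local-mono {φ = ψ} (ℕ.m≤n⊔m r r′) (ℕ.m≤n⊔m N N′) L′ m n N≤m N≤n I t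
  locality (φ ∨′ ψ) with locality φ | locality ψ
  ... | r , N , L | r′ , N′ , L′ = r ⊔ r′ , N ⊔ N′ , λ m n N≤m N≤n I → Sum.map
    (Local-mono {φ = φ} (ℕ.m≤m⊔n r r′) (ℕ.m≤m⊔n N N′) L m n N≤m N≤n I)
    (Local-mono {φ = ψ} (ℕ.m≤n⊔m r r′) (ℕ.m≤n⊔m N N′) L′ m n N≤m N≤n I)
  locality {p} (∀′ φ) with locality φ
  ... | r , N , L = Ext.s ℕ.+ r , N ⊔ Ext.N , λ m n N≤m N≤n I s w →
    let (v , J) = Ext.extension (ℕ.≤-trans (ℕ.m≤n⊔m N Ext.N) N≤n) (ℕ.≤-trans (ℕ.m≤n⊔m N Ext.N) N≤m)
                    (LocalIso-sym I) w
    in L m n (ℕ.≤-trans (ℕ.m≤m⊔n N Ext.N) N≤m) (ℕ.≤-trans (ℕ.m≤m⊔n N Ext.N) N≤n)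
         (LocalIso-sym J) (s v)
    where module Ext = Extension p r
  locality {p} (∃′ φ) with locality φ
  ... | r , N , L = Ext.s ℕ.+ r , N ⊔ Ext.N , λ m n N≤m N≤n I (v , s) →
    let (w , J) = Ext.extension (ℕ.≤-trans (ℕ.m≤n⊔m N Ext.N) N≤m) (ℕ.≤-trans (ℕ.m≤n⊔m N Ext.N) N≤n) I v
    in w , L m n (ℕ.≤-trans (ℕ.m≤m⊔n N Ext.N) N≤m) (ℕ.≤-trans (ℕ.m≤m⊔n N Ext.N) N≤n) J s
    where module Ext = Extension p r

-- Arithmetic of fractions

toℚᵘ-/ : ∀ i n .{{_ : NonZero n}} → toℚᵘ (i / n) ℚᵘ.≃ (i ℚᵘ./ n)
toℚᵘ-/ i (suc n) = ℚ.toℚᵘ-fromℚᵘ (ℚᵘ.mkℚᵘ i n)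

-- Normalised fractions are reduced to lowest terms; among unnormalised ones the product is the
-- claimed fraction by definition.
/-* : ∀ i j m n .{{_ : NonZero m}} .{{_ : NonZero n}} .{{_ : NonZero (m ℕ.* n)}} →
  (i / m) * (j / n) ≡ (i ℤ.* j) / (m ℕ.* n)
/-* i j m@(suc _) n@(suc _) = ℚ.toℚᵘ-injective (begin
  toℚᵘ ((i / m) * (j / n))       ≈⟨ ℚ.toℚᵘ-homo-* (i / m) (j / n) ⟩
  toℚᵘ (i / m) ℚᵘ.* toℚᵘ (j / n) ≈⟨ ℚᵘ.*-cong (toℚᵘ-/ i m) (toℚᵘ-/ j n) ⟩
  (i ℚᵘ./ m) ℚᵘ.* (j ℚᵘ./ n)     ≈⟨ toℚᵘ-/ (i ℤ.* j) (m ℕ.* n) ⟨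
  toℚᵘ ((i ℤ.* j) / (m ℕ.* n))   ∎)
  where open ℚᵘ.≃-Reasoning

fromℕ : ℕ → ℚ
fromℕ k = + k / 1

fromℕ-+ : ∀ j k → fromℕ (j ℕ.+ k) ≡ fromℕ j + fromℕ k
fromℕ-+ j k = ℚ.toℚᵘ-injective (begin
  toℚᵘ (fromℕ (j ℕ.+ k))                ≈⟨ toℚᵘ-/ (+ (j ℕ.+ k)) 1 ⟩
  + (j ℕ.+ k) ℚᵘ./ 1                    ≈⟨ ℚᵘ.*≡* (cong (ℤ._* + 1) (cong₂ ℤ._+_
                                             (sym (ℤ.*-identityʳ (+ j))) (sym (ℤ.*-identityʳ (+ k))))) ⟩
  (+ j ℚᵘ./ 1) ℚᵘ.+ (+ k ℚᵘ./ 1)        ≈⟨ ℚᵘ.+-cong (toℚᵘ-/ (+ j) 1) (toℚᵘ-/ (+ k) 1) ⟨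
  toℚᵘ (fromℕ j) ℚᵘ.+ toℚᵘ (fromℕ k)    ≈⟨ ℚ.toℚᵘ-homo-+ (fromℕ j) (fromℕ k) ⟨
  toℚᵘ (fromℕ j + fromℕ k)              ∎)
  where open ℚᵘ.≃-Reasoning

/≡fromℕ* : ∀ k n .{{_ : NonZero n}} → + k / n ≡ fromℕ k * (+ 1 / n)
/≡fromℕ* k n@(suc _) = sym (trans (/-* (+ k) (+ 1) 1 n)
  (ℚ./-cong (ℤ.*-identityʳ (+ k)) (ℕ.*-identityˡ n)))

n/n≡1 : ∀ n .{{_ : NonZero n}} → + n / n ≡ 1ℚ
n/n≡1 n@(suc _) = ℚ.toℚᵘ-injective (ℚᵘ.≃-trans (toℚᵘ-/ (+ n) n) (ℚᵘ.*≡* (ℤ.*-comm (+ n) (+ 1))))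

-- Finite sums of rationals

sum-mono : ∀ {n} {f g : Fin n → ℚ} → (∀ i → f i ≤ g i) → sum f ≤ sum g
sum-mono {zero}  f≤g = ℚ.≤-refl
sum-mono {suc n} f≤g = ℚ.+-mono-≤ (f≤g zero) (sum-mono (f≤g ∘ suc))

sum-+ : ∀ {n} (f g : Fin n → ℚ) → sum (λ i → f i + g i) ≡ sum f + sum g
sum-+ = SemiringSum.∑-distrib-+ (CommutativeRing.semiring ℚ.+-*-commutativeRing)

sum-const : ∀ n q → sum {n} (λ _ → q) ≡ fromℕ n * q
sum-const zero    q = sym (ℚ.*-zeroˡ q)
sum-const (suc n) q = begin
  q + sum {n} (λ _ → q)  ≡⟨ cong₂ _+_ (sym (ℚ.*-identityˡ q)) (sum-const n q) ⟩
  1ℚ * q + fromℕ n * q   ≡⟨ ℚ.*-distribʳ-+ q 1ℚ (fromℕ n) ⟨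
  (1ℚ + fromℕ n) * q     ≡⟨ cong (_* q) (fromℕ-+ 1 n) ⟨
  fromℕ (suc n) * q      ∎
  where open ≡-Reasoning

∣-∣-+ : ∀ {a b c d} → ∣ a ∣ ≤ c → ∣ b ∣ ≤ d → ∣ a + b ∣ ≤ c + d
∣-∣-+ {a} {b} a≤c b≤d = ℚ.≤-trans (ℚ.∣p+q∣≤∣p∣+∣q∣ a b) (ℚ.+-mono-≤ a≤c b≤d)

sum-∣-∣ : ∀ {n} {f h : Fin n → ℚ} → (∀ i → ∣ f i ∣ ≤ h i) → ∣ sum f ∣ ≤ sum h
sum-∣-∣ {zero}  f≤h = ℚ.≤-refl
sum-∣-∣ {suc n} {f} f≤h = ∣-∣-+ {f zero} (f≤h zero) (sum-∣-∣ (f≤h ∘ suc))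

sum-- : ∀ {n} (f g : Fin n → ℚ) → sum (λ i → f i - g i) ≡ sum f - sum g
sum-- {zero}  f g = refl
sum-- {suc n} f g = trans (cong (λ x → (f zero - g zero) + x) (sum-- (f ∘ suc) (g ∘ suc)))
  (solve 4 (λ a b c d → (a :- b) :+ (c :- d) := (a :+ c) :- (b :+ d)) refl
    (f zero) (g zero) (sum (f ∘ suc)) (sum (g ∘ suc)))

∣-∣-triangle : ∀ {a b c δ ε} → ∣ a - b ∣ ≤ δ → ∣ b - c ∣ ≤ ε → ∣ a - c ∣ ≤ δ + ε
∣-∣-triangle {a} {b} {c} {δ} {ε} ab bc = subst (λ x → ∣ x ∣ ≤ δ + ε)
  (solve 3 (λ a b c → (a :- b) :+ (b :- c) := a :- c) refl a b c)
  (∣-∣-+ {a - b} {b - c} ab bc)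

∣-∣-sym : ∀ a b → ∣ a - b ∣ ≡ ∣ b - a ∣
∣-∣-sym a b = trans (sym (ℚ.∣-p∣≡∣p∣ (a - b)))
  (cong ∣_∣ (solve 2 (λ a b → :- (a :- b) := b :- a) refl a b))

-- Means

ind : {A : Set} → Dec A → ℚ
ind a? = if does a? then 1ℚ else 0ℚ

0≤1 : 0ℚ ≤ 1ℚ
0≤1 = ℚ.nonNegative⁻¹ 1ℚ

ind-mono : {A B : Set} (a? : Dec A) (b? : Dec B) → (A → B) → ind a? ≤ ind b?
ind-mono (yes a) (yes b) f = ℚ.≤-refl
ind-mono (yes a) (no ¬b) f = contradiction (f a) ¬b
ind-mono (no ¬a) (yes b) f = 0≤1
ind-mono (no ¬a) (no ¬b) f = ℚ.≤-refl

ind-cong : {A B : Set} (a? : Dec A) (b? : Dec B) → A ⇔ B → ind a? ≡ ind b?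
ind-cong a? b? e = ℚ.≤-antisym (ind-mono a? b? (Equivalence.to e)) (ind-mono b? a? (Equivalence.from e))

ind-diff : {A B C : Set} (a? : Dec A) (b? : Dec B) (c? : Dec C) → (¬ C → A ⇔ B) →
  ∣ ind a? - ind b? ∣ ≤ ind c?
ind-diff (yes a) (yes b) (yes c) e = 0≤1
ind-diff (yes a) (yes b) (no ¬c) e = ℚ.≤-refl
ind-diff (no ¬a) (no ¬b) (yes c) e = 0≤1
ind-diff (no ¬a) (no ¬b) (no ¬c) e = ℚ.≤-refl
ind-diff (yes a) (no ¬b) (yes c) e = ℚ.≤-refl
ind-diff (no ¬a) (yes b) (yes c) e = ℚ.≤-refl
ind-diff (yes a) (no ¬b) (no ¬c) e = contradiction (Equivalence.to (e ¬c) a) ¬b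
ind-diff (no ¬a) (yes b) (no ¬c) e = contradiction (Equivalence.from (e ¬c) b) ¬a

∣ind∣≤1 : {A : Set} (a? : Dec A) → ∣ ind a? ∣ ≤ 1ℚ
∣ind∣≤1 (yes _) = ℚ.≤-refl
∣ind∣≤1 (no _)  = 0≤1

module _ (G : FiniteGraph) where
  private
    n = order G
    instance
      n≢0 : NonZero n
      n≢0 = FiniteGraph.nonEmpty G

  density : ℕ → ℚ
  density k = + k / n

  weight : ℚ
  weight = + 1 / n

  density≡ : ∀ k → density k ≡ fromℕ k * weight
  density≡ k = /≡fromℕ* k n

  instance
    weight-nonNeg : ℚ.NonNegative weight
    weight-nonNeg = ℚ.normalize-nonNeg 1 n

  mean : (Fin n → ℚ) → ℚ
  mean f = weight * sum f

  mean-const : ∀ q → mean (λ _ → q) ≡ q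
  mean-const q = begin
    weight * sum {n} (λ _ → q)   ≡⟨ cong (weight *_) (sum-const n q) ⟩
    weight * (fromℕ n * q)       ≡⟨ solve 3 (λ w k q → w :* (k :* q) := (k :* w) :* q) refl weight (fromℕ n) q ⟩
    (fromℕ n * weight) * q       ≡⟨ cong (_* q) (/≡fromℕ* n n) ⟨
    (+ n / n) * q                ≡⟨ cong (_* q) (n/n≡1 n) ⟩
    1ℚ * q                       ≡⟨ ℚ.*-identityˡ q ⟩
    q                            ∎
    where open ≡-Reasoning

  mean-cong : ∀ {f g} → (∀ v → f v ≡ g v) → mean f ≡ mean g
  mean-cong f≡g = cong (weight *_) (sum-cong-≗ f≡g)

  mean-mono : ∀ {f g} → (∀ v → f v ≤ g v) → mean f ≤ mean g
  mean-mono f≤g = ℚ.*-monoˡ-≤-nonNeg weight (sum-mono f≤g)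

  mean-≤ : ∀ {f q} → (∀ v → f v ≤ q) → mean f ≤ q
  mean-≤ {q = q} f≤q = ℚ.≤-trans (mean-mono f≤q) (ℚ.≤-reflexive (mean-const q))

  mean-+ : ∀ f g → mean (λ v → f v + g v) ≡ mean f + mean g
  mean-+ f g = trans (cong (weight *_) (sum-+ f g)) (ℚ.*-distribˡ-+ weight (sum f) (sum g))

  mean-- : ∀ f g → mean (λ v → f v - g v) ≡ mean f - mean g
  mean-- f g = trans (cong (weight *_) (sum-- f g))
    (solve 3 (λ w a b → w :* (a :- b) := w :* a :- w :* b) refl weight (sum f) (sum g))

  mean-∣-∣ : ∀ {f h} → (∀ v → ∣ f v ∣ ≤ h v) → ∣ mean f ∣ ≤ mean h
  mean-∣-∣ {f} {h} f≤h = begin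
    ∣ weight * sum f ∣      ≡⟨ ℚ.∣p*q∣≡∣p∣*∣q∣ weight (sum f) ⟩
    ∣ weight ∣ * ∣ sum f ∣  ≡⟨ cong (_* ∣ sum f ∣) (ℚ.0≤p⇒∣p∣≡p (ℚ.nonNegative⁻¹ weight)) ⟩
    weight * ∣ sum f ∣      ≤⟨ ℚ.*-monoˡ-≤-nonNeg weight (sum-∣-∣ f≤h) ⟩
    weight * sum h          ∎
    where open ℚ.≤-Reasoning

  mean-diff : ∀ {f g h} → (∀ v → ∣ f v - g v ∣ ≤ h v) → ∣ mean f - mean g ∣ ≤ mean h
  mean-diff {f} {g} {h} f-g≤h = subst (λ x → ∣ x ∣ ≤ mean h) (mean-- f g) (mean-∣-∣ f-g≤h)

  -- The uniform mean over tuples, written as an iterated mean so that inductions on `p` treat one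
  -- vertex at a time.
  expect : ∀ p → (Vec (Fin n) p → ℚ) → ℚ
  expect zero    f = f []
  expect (suc p) f = mean λ v → expect p λ ρ → f (v ∷ ρ)

  expect-mono : ∀ p {f g} → (∀ ρ → f ρ ≤ g ρ) → expect p f ≤ expect p g
  expect-mono zero    f≤g = f≤g []
  expect-mono (suc p) f≤g = mean-mono λ v → expect-mono p λ ρ → f≤g (v ∷ ρ)

  expect-const : ∀ p q → expect p (λ _ → q) ≡ q
  expect-const zero    q = refl
  expect-const (suc p) q = trans (mean-cong λ _ → expect-const p q) (mean-const q)

  expect-+ : ∀ p f g → expect p (λ ρ → f ρ + g ρ) ≡ expect p f + expect p g
  expect-+ zero    f g = refl
  expect-+ (suc p) f g = trans (mean-cong λ v → expect-+ p (λ ρ → f (v ∷ ρ)) (λ ρ → g (v ∷ ρ)))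
    (mean-+ (λ v → expect p λ ρ → f (v ∷ ρ)) (λ v → expect p λ ρ → g (v ∷ ρ)))

  expect-diff : ∀ p {f g h} → (∀ ρ → ∣ f ρ - g ρ ∣ ≤ h ρ) → ∣ expect p f - expect p g ∣ ≤ expect p h
  expect-diff zero    f-g≤h = f-g≤h []
  expect-diff (suc p) f-g≤h = mean-diff λ v → expect-diff p λ ρ → f-g≤h (v ∷ ρ)

  expect-bounded : ∀ p {f q} → (∀ ρ → ∣ f ρ ∣ ≤ q) → ∣ expect p f ∣ ≤ q
  expect-bounded zero    f≤q = f≤q []
  expect-bounded (suc p) {q = q} f≤q = ℚ.≤-trans (mean-∣-∣ λ v → expect-bounded p λ ρ → f≤q (v ∷ ρ))
    (ℚ.≤-reflexive (mean-const q))

-- Densities as means of indicators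

module _ {A : Set} {P : Pred A 0ℓ} (P? : Decidable P) where

  count-++ : ∀ xs ys → count P? (xs List.++ ys) ≡ count P? xs ℕ.+ count P? ys
  count-++ xs ys = trans (cong length (filter-++ P? xs ys)) (length-++ (filter P? xs))

  count-map : {B : Set} (f : B → A) → ∀ xs → count P? (List.map f xs) ≡ count (P? ∘ f) xs
  count-map f []       = refl
  count-map f (x ∷ xs) with P? (f x)
  ... | yes _ = cong suc (count-map f xs)
  ... | no  _ = count-map f xs

  count-∷ : ∀ x xs → fromℕ (count P? (x ∷ xs)) ≡ ind (P? x) + fromℕ (count P? xs)
  count-∷ x xs with P? x
  ... | yes _ = fromℕ-+ 1 (count P? xs)
  ... | no  _ = sym (ℚ.+-identityˡ _)

  count-tabulate : ∀ {n} (f : Fin n → A) →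
    fromℕ (count P? (List.tabulate f)) ≡ sum (λ i → ind (P? (f i)))
  count-tabulate {zero}  f = refl
  count-tabulate {suc n} f = trans (count-∷ (f zero) _) (cong (λ x → ind (P? (f zero)) + x) (count-tabulate (f ∘ suc)))

count-product : ∀ {A : Set} {n p} {P : Pred (Vec A (suc p)) 0ℓ} (P? : Decidable P) (f : Fin n → A) ρs →
  fromℕ (count P? (cartesianProductWith _∷_ (List.tabulate f) ρs)) ≡
  sum (λ i → fromℕ (count (λ ρ → P? (f i ∷ ρ)) ρs))
count-product {n = zero}  P? f ρs = refl
count-product {n = suc n} P? f ρs = begin
  fromℕ (count P? (List.map (f zero ∷_) ρs List.++ rest))
    ≡⟨ cong fromℕ (count-++ P? (List.map (f zero ∷_) ρs) rest) ⟩
  fromℕ (count P? (List.map (f zero ∷_) ρs) ℕ.+ count P? rest)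
    ≡⟨ fromℕ-+ (count P? (List.map (f zero ∷_) ρs)) (count P? rest) ⟩
  fromℕ (count P? (List.map (f zero ∷_) ρs)) + fromℕ (count P? rest)
    ≡⟨ cong₂ _+_ (cong fromℕ (count-map P? (f zero ∷_) ρs)) (count-product P? (f ∘ suc) ρs) ⟩
  fromℕ (count (λ ρ → P? (f zero ∷ ρ)) ρs) + sum (λ i → fromℕ (count (λ ρ → P? (f (suc i) ∷ ρ)) ρs)) ∎
  where
  open ≡-Reasoning
  rest = cartesianProductWith _∷_ (List.tabulate (f ∘ suc)) ρs

module _ (G : FiniteGraph) where
  private
    n = order G
    instance
      n≢0 : NonZero n
      n≢0 = FiniteGraph.nonEmpty G

    tupleWeight : ℕ → ℚ
    tupleWeight p = (+ 1 / (n ℕ.^ p)) {{ℕ.m^n≢0 n p}}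

    tupleWeight-suc : ∀ p → tupleWeight (suc p) ≡ weight G * tupleWeight p
    tupleWeight-suc p = sym (/-* (+ 1) (+ 1) n (n ℕ.^ p) {{n≢0}} {{ℕ.m^n≢0 n p}} {{ℕ.m^n≢0 n (suc p)}})

  mean-density : {P : Pred (Fin n) 0ℓ} (P? : Decidable P) →
    density G (count P? (allFin n)) ≡ mean G (λ v → ind (P? v))
  mean-density P? = trans (/≡fromℕ* (count P? (allFin n)) n)
    (trans (ℚ.*-comm (fromℕ (count P? (allFin n))) (weight G)) (cong (weight G *_) (count-tabulate P? id)))

  count-tuples : ∀ p {P : Pred (Vec (Fin n) p) 0ℓ} (P? : Decidable P) →
    fromℕ (count P? (tuples n p)) * tupleWeight p ≡ expect G p (λ ρ → ind (P? ρ))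
  count-tuples zero P? with P? []
  ... | yes _ = refl
  ... | no  _ = refl
  count-tuples (suc p) P? = begin
    fromℕ (count P? (tuples n (suc p))) * tupleWeight (suc p)
      ≡⟨ cong₂ _*_ (count-product P? id (tuples n p)) (tupleWeight-suc p) ⟩
    sum counts * (weight G * tupleWeight p)
      ≡⟨ solve 3 (λ s w t → s :* (w :* t) := w :* (s :* t)) refl (sum counts) (weight G) (tupleWeight p) ⟩
    weight G * (sum counts * tupleWeight p)
      ≡⟨ cong (weight G *_) (*-distribʳ-sum (tupleWeight p) counts) ⟩
    mean G (λ v → counts v * tupleWeight p)
      ≡⟨ mean-cong G (λ v → count-tuples p (λ ρ → P? (v ∷ ρ))) ⟩
    expect G (suc p) (λ ρ → ind (P? ρ)) ∎
    where
    open ≡-Reasoning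
    counts : Fin n → ℚ
    counts v = fromℕ (count (λ ρ → P? (v ∷ ρ)) (tuples n p))

  expect-density : ∀ p {P : Pred (Vec (Fin n) p) 0ℓ} (P? : Decidable P) →
    (+ count P? (tuples n p) / (n ℕ.^ p)) {{ℕ.m^n≢0 n p}} ≡ expect G p (λ ρ → ind (P? ρ))
  expect-density p P? = trans (/≡fromℕ* (count P? (tuples n p)) (n ℕ.^ p) {{ℕ.m^n≢0 n p}}) (count-tuples p P?)

-- Cauchy sequences

half : ℚ → ℚ
half ε = ½ * ε

half+half : ∀ ε → half ε + half ε ≡ ε
half+half ε = trans (sym (ℚ.*-distribʳ-+ ε ½ ½)) (ℚ.*-identityˡ ε)

half>0 : ∀ {ε} → 0ℚ < ε → 0ℚ < half ε
half>0 {ε} ε>0 = ℚ.positive⁻¹ (half ε) {{ℚ.pos*pos⇒pos ½ ε {{ℚ.positive ε>0}}}}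

half< : ∀ {ε} → 0ℚ < ε → half ε < ε
half< {ε} ε>0 = subst₂ _<_ (ℚ.+-identityʳ (half ε)) (half+half ε)
  (ℚ.+-monoʳ-< (half ε) (half>0 ε>0))

-- Estimates for sums and means arrive as nonstrict inequalities; halving `ε` restores the strict
-- form.
IsCauchy≤ : (ℕ → ℚ) → Set
IsCauchy≤ a = ∀ ε → 0ℚ < ε →
  ∃ λ N → ∀ m n → N ℕ.≤ m → N ℕ.≤ n → ∣ a m - a n ∣ ≤ ε

IsCauchy≤⇒IsCauchy : ∀ a → IsCauchy≤ a → IsCauchy a
IsCauchy≤⇒IsCauchy a cauchy ε ε>0 =
  let (N , close) = cauchy (half ε) (half>0 ε>0) in
  N , λ m n N≤m N≤n → ℚ.≤-<-trans (close m n N≤m N≤n) (half< ε>0)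

-- The sequence itself represents its limit, and `half ε` is the rational strictly below `ε` that
-- `∣_-_∣<_` asks for.
IsCauchy⇒Converges : ∀ a → IsCauchy a → Converges a
IsCauchy⇒Converges a cauchy = record { approx = a ; isCauchy = cauchy } , λ ε ε>0 →
  let (N , close) = cauchy (half ε) (half>0 ε>0) in
  N , λ n N≤n → half ε , half< ε>0 , N , λ k N≤k → ℚ.<⇒≤ (close n k N≤n N≤k)

Converges⇒IsCauchy≤ : ∀ a → Converges a → IsCauchy≤ a
Converges⇒IsCauchy≤ a (x , lim) ε ε>0 =
  let (N , close) = lim (half ε) (half>0 ε>0) in
  N , λ m n N≤m N≤n →
    let (δ , δ<½ε , K , near-m) = close m N≤m
        (η , η<½ε , L , near-n) = close n N≤n
        k = K ⊔ L
        am-xk = ℚ.≤-trans (near-m k (ℕ.m≤m⊔n K L)) (ℚ.<⇒≤ δ<½ε)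
        xk-an = ℚ.≤-trans (ℚ.≤-reflexive (∣-∣-sym (ℝ.approx x k) (a n)))
                  (ℚ.≤-trans (near-n k (ℕ.m≤n⊔m K L)) (ℚ.<⇒≤ η<½ε))
    in subst (∣ a m - a n ∣ ≤_) (half+half ε) (∣-∣-triangle {a m} {ℝ.approx x k} {a n} am-xk xk-an)

IsCauchy≤-resp : ∀ a {b} → (∀ n → a n ≡ b n) → IsCauchy≤ a → IsCauchy≤ b
IsCauchy≤-resp a a≡b cauchy ε ε>0 = let (N , close) = cauchy ε ε>0 in
  N , λ m n N≤m N≤n → subst₂ (λ x y → ∣ x - y ∣ ≤ ε) (a≡b m) (a≡b n) (close m n N≤m N≤n)

Converges-resp : ∀ a b → (∀ n → a n ≡ b n) → Converges a → Converges b
Converges-resp a b a≡b conv = IsCauchy⇒Converges b (IsCauchy≤⇒IsCauchy b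
  (IsCauchy≤-resp a a≡b (Converges⇒IsCauchy≤ a conv)))

sum-Cauchy : ∀ {t} (a : Fin t → ℕ → ℚ) → (∀ i → IsCauchy≤ (a i)) → ∀ ε → 0ℚ < ε →
  ∃ λ N → ∀ m n → N ℕ.≤ m → N ℕ.≤ n → sum (λ i → ∣ a i m - a i n ∣) ≤ ε
sum-Cauchy {zero}  a cauchy ε ε>0 = 0 , λ _ _ _ _ → ℚ.<⇒≤ ε>0
sum-Cauchy {suc t} a cauchy ε ε>0 =
  let (M , close)  = cauchy zero (half ε) (half>0 ε>0)
      (N , closer) = sum-Cauchy (a ∘ suc) (cauchy ∘ suc) (half ε) (half>0 ε>0)
  in M ⊔ N , λ m n M⊔N≤m M⊔N≤n → ℚ.≤-trans
    (ℚ.+-mono-≤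
      (close m n (ℕ.≤-trans (ℕ.m≤m⊔n M N) M⊔N≤m) (ℕ.≤-trans (ℕ.m≤m⊔n M N) M⊔N≤n))
      (closer m n (ℕ.≤-trans (ℕ.m≤n⊔m M N) M⊔N≤m) (ℕ.≤-trans (ℕ.m≤n⊔m M N) M⊔N≤n)))
    (ℚ.≤-reflexive (half+half ε))

/-≤ : ∀ {b a e n} .{c : Coprime (suc a) (suc e)} → b ℕ.* suc e ℕ.≤ n → .{{_ : NonZero n}} →
  + b / n ≤ mkℚ (+ suc a) e c
/-≤ {b} {a} {e} {n@(suc _)} be≤n = ℚ.toℚᵘ-cancel-≤ (ℚᵘ.≤-respˡ-≃ (ℚᵘ.≃-sym (toℚᵘ-/ (+ b) n))
  (ℚᵘ.*≤* (subst₂ ℤ._≤_ (ℤ.pos-* b (suc e)) (ℤ.pos-* (suc a) n)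
    (ℤ.+≤+ (ℕ.≤-trans be≤n (ℕ.m≤m+n n (a ℕ.* n)))))))

archimedean : ∀ b ε → 0ℚ < ε → ∃ λ K → ∀ n .{{_ : NonZero n}} → K ℕ.≤ n → + b / n ≤ ε
-- A positive rational with denominator `suc e` is at least `1 / suc e`.
archimedean b (mkℚ (+ suc a) e c) ε>0 = b ℕ.* suc e , λ n K≤n → /-≤ {b} {a} {e} {n} {c} K≤n
archimedean b (mkℚ (+ zero)  e c) ε>0 with ℚ.drop-*<* ε>0
... | ℤ.+<+ ()
archimedean b (mkℚ (-[1+ a ]) e c) ε>0 with ℚ.drop-*<* ε>0
... | ()

fromℕ-mono : ∀ {j k} → j ℕ.≤ k → fromℕ j ≤ fromℕ k
fromℕ-mono {j} {k} j≤k = subst (fromℕ j ≤_)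
  (trans (sym (fromℕ-+ j (k ℕ.∸ j))) (cong fromℕ (ℕ.m+[n∸m]≡n j≤k)))
  (subst (_≤ fromℕ j + fromℕ (k ℕ.∸ j)) (ℚ.+-identityʳ (fromℕ j))
    (ℚ.+-monoʳ-≤ (fromℕ j) (ℚ.nonNegative⁻¹ (fromℕ (k ℕ.∸ j)) {{ℚ.normalize-nonNeg (k ℕ.∸ j) 1}})))

density-mono : ∀ G {j k} → j ℕ.≤ k → density G j ≤ density G k
density-mono G {j} {k} j≤k = subst₂ _≤_ (sym (density≡ G j)) (sym (density≡ G k))
  (ℚ.*-monoʳ-≤-nonNeg (weight G) {{weight-nonNeg G}} (fromℕ-mono j≤k))

ind-⊎ : ∀ {A B C : Set} (a? : Dec A) (b? : Dec B) (c? : Dec C) → (A → B ⊎ C) →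
  ind a? ≤ ind b? + ind c?
ind-⊎ (no _)  (yes _) (yes _) f = ℚ.nonNegative⁻¹ (1ℚ + 1ℚ)
ind-⊎ (no _)  (yes _) (no _)  f = 0≤1
ind-⊎ (no _)  (no _)  (yes _) f = 0≤1
ind-⊎ (no _)  (no _)  (no _)  f = ℚ.≤-refl
ind-⊎ (yes a) b? c? f with f a
ind-⊎ (yes a) (yes _) (yes _) f | _      = ℚ.≤ᵇ⇒≤ {1ℚ} {1ℚ + 1ℚ} tt
ind-⊎ (yes a) (yes _) (no _)  f | _      = ℚ.≤-refl
ind-⊎ (yes a) (no _)  (yes _) f | _      = ℚ.≤-refl
ind-⊎ (yes a) (no ¬b) (no ¬c) f | inj₁ b = contradiction b ¬b
ind-⊎ (yes a) (no ¬b) (no ¬c) f | inj₂ c = contradiction c ¬c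

-- Samples of vertices are scattered with high probability

module _ (G : FiniteGraph) (s : ℕ) where

  Scattered : ∀ {p} → Vec (Vertex G) p → Set
  Scattered []      = ⊤
  Scattered (v ∷ ρ) = ¬ Near (graph G) s ρ v × Scattered ρ

  scattered? : ∀ {p} (ρ : Vec (Vertex G) p) → Dec (Scattered ρ)
  scattered? []      = yes tt
  scattered? (v ∷ ρ) = ¬? (near? G s ρ v) ×-dec scattered? ρ

module Sampling (d : ℕ) (𝒢 : ℕ → FiniteGraph) (deg≤d : ∀ n → MaxDegree≤ d (𝒢 n))
                (infinite : OrderTendsToInfinity 𝒢) (s : ℕ) where

  rare-ball : ∀ ε → 0ℚ < ε → ∃ λ N → ∀ n → N ℕ.≤ n → ∀ v →
    mean (𝒢 n) (λ u → ind (dist≤? (𝒢 n) s u v)) ≤ ε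
  rare-ball ε ε>0 =
    -- The factor 1 is the length of the tuple `v ∷ []` in `near-length≤`.
    let b = 1 ℕ.* ballSize d s
        (K , small) = archimedean b ε ε>0
        (N , large) = infinite K
    in N , λ n N≤n v → let G = 𝒢 n in begin
      mean G (λ u → ind (dist≤? G s u v))          ≡⟨ mean-density G (λ u → dist≤? G s u v) ⟨
      density G (count (λ u → dist≤? G s u v) (allFin _))   ≤⟨ density-mono G
          (near-length≤ G (deg≤d n) {p = 1} {ρ = v ∷ []}
          (Unique.filter⁺ (λ u → dist≤? G s u v) (Unique.allFin⁺ _))
          (λ u∈ → zero , dist-sym (proj₂ (∈-filter⁻ (λ u → dist≤? G s u v) {xs = allFin _} u∈)))) ⟩
      density G b                                          ≤⟨ small (order G) {{FiniteGraph.nonEmpty G}} (large n N≤n) ⟩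
      ε                                                    ∎
    where open ℚ.≤-Reasoning

  -- A union bound over the entries of the tuple. The index does not depend on `v`, so the estimate
  -- can later be averaged over a random `v`.
  rare-near : ∀ p ε → 0ℚ < ε → ∃ λ N → ∀ n → N ℕ.≤ n → ∀ v →
    expect (𝒢 n) p (λ ρ → ind (near? (𝒢 n) s ρ v)) ≤ ε
  rare-near zero    ε ε>0 = 0 , λ n _ v → ℚ.<⇒≤ ε>0
  rare-near (suc p) ε ε>0 =
    let (M , ball)  = rare-ball (half ε) (half>0 ε>0)
        (N , nears) = rare-near p (half ε) (half>0 ε>0)
    in M ⊔ N , λ n M⊔N≤n v → let G = 𝒢 n in begin
      expect G (suc p) (λ ρ → ind (near? G s ρ v))
        ≤⟨ mean-mono G (λ u → expect-mono G p (λ ρ →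
             ind-⊎ (near? G s (u ∷ ρ) v) (dist≤? G s u v) (near? G s ρ v)
               (λ { (zero , δ) → inj₁ δ ; (suc i , δ) → inj₂ (i , δ) }))) ⟩
      mean G (λ u → expect G p (λ ρ → ind (dist≤? G s u v) + ind (near? G s ρ v)))
        ≡⟨ mean-cong G (λ u → trans (expect-+ G p (λ _ → ind (dist≤? G s u v)) (λ ρ → ind (near? G s ρ v)))
             (cong (λ x → x + E n v) (expect-const G p (ind (dist≤? G s u v))))) ⟩
      mean G (λ u → ind (dist≤? G s u v) + E n v)
        ≡⟨ mean-+ G (λ u → ind (dist≤? G s u v)) (λ _ → E n v) ⟩
      mean G (λ u → ind (dist≤? G s u v)) + mean G (λ _ → E n v)
        ≤⟨ ℚ.+-mono-≤ (ball n (ℕ.≤-trans (ℕ.m≤m⊔n M N) M⊔N≤n) v)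
             (mean-≤ G (λ _ → nears n (ℕ.≤-trans (ℕ.m≤n⊔m M N) M⊔N≤n) v)) ⟩
      half ε + half ε
        ≡⟨ half+half ε ⟩
      ε ∎
    where
    open ℚ.≤-Reasoning
    E : ∀ n → Vertex (𝒢 n) → ℚ
    E n v = expect (𝒢 n) p (λ ρ → ind (near? (𝒢 n) s ρ v))

  clustered : ∀ p n → ℚ
  clustered p n = expect (𝒢 n) p (λ ρ → ind (¬? (scattered? (𝒢 n) s ρ)))

  rare-clustered : ∀ p ε → 0ℚ < ε → ∃ λ N → ∀ n → N ℕ.≤ n → clustered p n ≤ ε
  rare-clustered zero    ε ε>0 = 0 , λ n _ → ℚ.<⇒≤ ε>0
  rare-clustered (suc p) ε ε>0 =
    let (M , nears) = rare-near p (half ε) (half>0 ε>0)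
        (N , rest)  = rare-clustered p (half ε) (half>0 ε>0)
    in M ⊔ N , λ n M⊔N≤n → let G = 𝒢 n in begin
      clustered (suc p) n
        ≤⟨ mean-mono G (λ v → expect-mono G p (λ ρ →
             ind-⊎ (¬? (scattered? G s (v ∷ ρ))) (near? G s ρ v) (¬? (scattered? G s ρ)) (split G v ρ))) ⟩
      mean G (λ v → expect G p (λ ρ → ind (near? G s ρ v) + ind (¬? (scattered? G s ρ))))
        ≤⟨ mean-≤ G (λ v → ℚ.≤-trans (ℚ.≤-reflexive
               (expect-+ G p (λ ρ → ind (near? G s ρ v)) (λ ρ → ind (¬? (scattered? G s ρ)))))
             (ℚ.+-mono-≤ (nears n (ℕ.≤-trans (ℕ.m≤m⊔n M N) M⊔N≤n) v)
                         (rest n (ℕ.≤-trans (ℕ.m≤n⊔m M N) M⊔N≤n)))) ⟩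
      half ε + half ε
        ≡⟨ half+half ε ⟩
      ε ∎
    where
    open ℚ.≤-Reasoning
    split : ∀ G v (ρ : Vec (Vertex G) p) → ¬ Scattered G s (v ∷ ρ) →
            Near (graph G) s ρ v ⊎ ¬ Scattered G s ρ
    split G v ρ ¬sc with near? G s ρ v
    ... | yes near = inj₁ near
    ... | no  far  = inj₂ (λ sc → ¬sc (far , sc))

-- Independent samples are compared through the frequencies of their types

module _ {t : ℕ} where

  frequency : ∀ G → (Vertex G → Fin t) → Fin t → ℚ
  frequency G τ i = mean G (λ v → ind (τ v Fin.≟ i))

  sum-ind : ∀ {t} (j : Fin t) (g : Fin t → ℚ) → sum (λ i → ind (j Fin.≟ i) * g i) ≡ g j
  sum-ind {suc t} zero g = begin
    1ℚ * g zero + sum (λ i → 0ℚ * g (suc i))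
      ≡⟨ cong₂ _+_ (ℚ.*-identityˡ (g zero)) (sym (*-distribˡ-sum 0ℚ (g ∘ suc))) ⟩
    g zero + 0ℚ * sum (g ∘ suc)
      ≡⟨ cong (λ x → g zero + x) (ℚ.*-zeroˡ (sum (g ∘ suc))) ⟩
    g zero + 0ℚ
      ≡⟨ ℚ.+-identityʳ (g zero) ⟩
    g zero ∎
    where open ≡-Reasoning
  sum-ind {suc t} (suc j) g = begin
    0ℚ * g zero + sum (λ i → ind (suc j Fin.≟ suc i) * g (suc i))
      ≡⟨ cong₂ _+_ (ℚ.*-zeroˡ (g zero)) (sum-cong-≗ (λ i → cong (_* g (suc i))
           (ind-cong (suc j Fin.≟ suc i) (j Fin.≟ i) (mk⇔ Fin.suc-injective (cong suc))))) ⟩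
    0ℚ + sum (λ i → ind (j Fin.≟ i) * g (suc i))
      ≡⟨ ℚ.+-identityˡ _ ⟩
    sum (λ i → ind (j Fin.≟ i) * g (suc i))
      ≡⟨ sum-ind j (g ∘ suc) ⟩
    g (suc j) ∎
    where open ≡-Reasoning

  mean-by-type : ∀ G (τ : Vertex G → Fin t) (g : Fin t → ℚ) →
    mean G (g ∘ τ) ≡ sum (λ i → frequency G τ i * g i)
  mean-by-type G τ g = begin
    weight G * sum (g ∘ τ)
      ≡⟨ cong (weight G *_) (sum-cong-≗ (λ v → sym (sum-ind (τ v) g))) ⟩
    weight G * sum (λ v → sum (λ i → ind (τ v Fin.≟ i) * g i))
      ≡⟨ cong (weight G *_) (∑-comm (λ v i → ind (τ v Fin.≟ i) * g i)) ⟩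
    weight G * sum (λ i → sum (λ v → ind (τ v Fin.≟ i) * g i))
      ≡⟨ *-distribˡ-sum (weight G) (λ i → sum (λ v → ind (τ v Fin.≟ i) * g i)) ⟩
    sum (λ i → weight G * sum (λ v → ind (τ v Fin.≟ i) * g i))
      ≡⟨ sum-cong-≗ (λ i → trans
           (cong (weight G *_) (sym (*-distribʳ-sum (g i) (λ v → ind (τ v Fin.≟ i)))))
           (sym (ℚ.*-assoc (weight G) (sum (λ v → ind (τ v Fin.≟ i))) (g i)))) ⟩
    sum (λ i → frequency G τ i * g i) ∎
    where open ≡-Reasoning

  mean-compare : ∀ G H (τ : Vertex G → Fin t) (υ : Vertex H → Fin t)
    (g : Fin t → ℚ) → (∀ i → ∣ g i ∣ ≤ 1ℚ) →
    ∣ mean G (g ∘ τ) - mean H (g ∘ υ) ∣ ≤ sum (λ i → ∣ frequency G τ i - frequency H υ i ∣)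
  mean-compare G H τ υ g g≤1 = begin
    ∣ mean G (g ∘ τ) - mean H (g ∘ υ) ∣
      ≡⟨ cong ∣_∣ (trans (cong₂ _-_ (mean-by-type G τ g) (mean-by-type H υ g))
           (sym (sum-- (λ i → frequency G τ i * g i) (λ i → frequency H υ i * g i)))) ⟩
    ∣ sum (λ i → frequency G τ i * g i - frequency H υ i * g i) ∣
      ≤⟨ sum-∣-∣ bound ⟩
    sum (λ i → ∣ frequency G τ i - frequency H υ i ∣) ∎
    where
    open ℚ.≤-Reasoning
    bound : ∀ i → ∣ frequency G τ i * g i - frequency H υ i * g i ∣ ≤ ∣ frequency G τ i - frequency H υ i ∣
    bound i = let a = frequency G τ i ; b = frequency H υ i in begin
      ∣ a * g i - b * g i ∣  ≡⟨ cong ∣_∣ (solve 3 (λ a b x → a :* x :- b :* x := (a :- b) :* x) refl a b (g i)) ⟩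
      ∣ (a - b) * g i ∣      ≡⟨ ℚ.∣p*q∣≡∣p∣*∣q∣ (a - b) (g i) ⟩
      ∣ a - b ∣ * ∣ g i ∣    ≤⟨ ℚ.*-monoˡ-≤-nonNeg ∣ a - b ∣ {{ℚ.∣-∣-nonNeg (a - b)}} (g≤1 i) ⟩
      ∣ a - b ∣ * 1ℚ         ≡⟨ ℚ.*-identityʳ ∣ a - b ∣ ⟩
      ∣ a - b ∣              ∎

  module _ (𝒢 : ℕ → FiniteGraph) (τ : ∀ n → Vertex (𝒢 n) → Fin t)
           (cauchy : ∀ i → IsCauchy≤ (λ n → frequency (𝒢 n) (τ n) i)) where

    -- `F` is quantified after the index: the functions to which this is applied depend on `m` and
    -- `n` themselves.
    expect-Cauchy : ∀ p ε → 0ℚ < ε → ∃ λ N → ∀ m n → N ℕ.≤ m → N ℕ.≤ n →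
      (F : Vec (Fin t) p → ℚ) → (∀ x → ∣ F x ∣ ≤ 1ℚ) →
      ∣ expect (𝒢 m) p (λ ρ → F (Vec.map (τ m) ρ)) -
        expect (𝒢 n) p (λ ρ → F (Vec.map (τ n) ρ)) ∣ ≤ ε
    expect-Cauchy zero    ε ε>0 = 0 , λ _ _ _ _ F _ →
      subst (_≤ ε) (sym (cong ∣_∣ (ℚ.+-inverseʳ (F [])))) (ℚ.<⇒≤ ε>0)
    expect-Cauchy (suc p) ε ε>0 =
      let (M , IH)    = expect-Cauchy p (half ε) (half>0 ε>0)
          (N , close) = sum-Cauchy (λ i n → frequency (𝒢 n) (τ n) i) cauchy (half ε) (half>0 ε>0)
      in M ⊔ N , λ m n M⊔N≤m M⊔N≤n F F≤1 →
        let H : ℕ → Fin t → ℚ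
            H k i = expect (𝒢 k) p (λ ρ → F (i ∷ Vec.map (τ k) ρ))
        -- The intermediate mean draws the first vertex from `𝒢 m` and the others from `𝒢 n`. The
        -- induction hypothesis exchanges the others; the frequencies account for the first, since
        -- `H n` is bounded by 1.
        in subst (∣ mean (𝒢 m) (H m ∘ τ m) - mean (𝒢 n) (H n ∘ τ n) ∣ ≤_) (half+half ε)
          (∣-∣-triangle {mean (𝒢 m) (H m ∘ τ m)} {mean (𝒢 m) (H n ∘ τ m)}
                        {mean (𝒢 n) (H n ∘ τ n)}
            (ℚ.≤-trans
              (mean-diff (𝒢 m) (λ v → IH m n (ℕ.≤-trans (ℕ.m≤m⊔n M N) M⊔N≤m)
                (ℕ.≤-trans (ℕ.m≤m⊔n M N) M⊔N≤n) (λ x → F (τ m v ∷ x)) (λ x → F≤1 (τ m v ∷ x))))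
              (ℚ.≤-reflexive (mean-const (𝒢 m) (half ε))))
            (ℚ.≤-trans
              (mean-compare (𝒢 m) (𝒢 n) (τ m) (τ n) (H n)
                (λ i → expect-bounded (𝒢 n) p (λ ρ → F≤1 (i ∷ Vec.map (τ n) ρ))))
              (close m n (ℕ.≤-trans (ℕ.m≤n⊔m M N) M⊔N≤m) (ℕ.≤-trans (ℕ.m≤n⊔m M N) M⊔N≤n))))

-- From FO-convergence to BS-convergence and elementary convergence

⟨⟩≡expect : ∀ {p} (φ : Formula p) G → ⟨ φ , G ⟩ ≡ expect G p (λ ρ → ind (sat? G φ ρ))
⟨⟩≡expect φ G = expect-density G _ (sat? G φ)

ballDensity≡mean : ∀ r F o G → ballDensity r F o G ≡ mean G (λ v → ind (ball≅? G v r F o))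
ballDensity≡mean r F o G = mean-density G (λ v → ball≅? G v r F o)

⟨hasBall⟩≡ballDensity : ∀ r F o G → ⟨ hasBall r F o {1} zero , G ⟩ ≡ ballDensity r F o G
⟨hasBall⟩≡ballDensity r F o G = trans (⟨⟩≡expect (hasBall r F o zero) G)
  (trans (mean-cong G (λ v → ind-cong (sat? G (hasBall r F o zero) (v ∷ [])) (ball≅? G v r F o)
           (hasBall-⇔ r F o G (v ∷ []) zero)))
    (sym (ballDensity≡mean r F o G)))

FO⇒BS : ∀ d 𝒢 → FOConvergent 𝒢 → BSConvergent d 𝒢
FO⇒BS d 𝒢 fo r F o _ _ = Converges-resp (λ n → ⟨ hasBall r F o {1} zero , 𝒢 n ⟩) (λ n → ballDensity r F o (𝒢 n))
  (λ n → ⟨hasBall⟩≡ballDensity r F o (𝒢 n)) (fo (hasBall r F o {1} zero))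

-- Truth values at distance at most `½` coincide, so all graphs from `N` on agree about `θ`, and
-- deciding `θ` in `𝒢 N` tells which case holds.
FO⇒elementary : ∀ 𝒢 → FOConvergent 𝒢 → ElementarilyConvergent 𝒢
FO⇒elementary 𝒢 fo θ = decide (sat? (𝒢 N) θ [])
  where
  truth : ℕ → ℚ
  truth n = ind (sat? (𝒢 n) θ [])

  cauchy : IsCauchy≤ truth
  cauchy = IsCauchy≤-resp (λ n → ⟨ θ , 𝒢 n ⟩) (λ n → ⟨⟩≡expect θ (𝒢 n))
    (Converges⇒IsCauchy≤ (λ n → ⟨ θ , 𝒢 n ⟩) (fo θ))

  ½>0 : 0ℚ < ½
  ½>0 = ℚ.positive⁻¹ ½

  N : ℕ
  N = proj₁ (cauchy ½ ½>0)

  ind-close : ∀ {A B : Set} (a? : Dec A) (b? : Dec B) → ∣ ind a? - ind b? ∣ ≤ ½ → A → B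
  ind-close (yes _) (yes b) _   _ = b
  ind-close (yes _) (no _)  1≤½ _ = contradiction (ℚ.<-≤-trans (half< {1ℚ} (ℚ.positive⁻¹ 1ℚ)) 1≤½) (ℚ.<-irrefl refl)
  ind-close (no ¬a) _       _   a = contradiction a ¬a

  close : ∀ m n → N ℕ.≤ m → N ℕ.≤ n → graph (𝒢 m) ⊨ θ [ [] ] → graph (𝒢 n) ⊨ θ [ [] ]
  close m n N≤m N≤n = ind-close (sat? (𝒢 m) θ []) (sat? (𝒢 n) θ []) (proj₂ (cauchy ½ ½>0) m n N≤m N≤n)

  decide : Dec (graph (𝒢 N) ⊨ θ [ [] ]) →
    Eventually (λ n → graph (𝒢 n) ⊨ θ [ [] ]) ⊎ Eventually (λ n → ¬ (graph (𝒢 n) ⊨ θ [ [] ]))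
  decide (yes s) = inj₁ (N , λ n N≤n → close N n ℕ.≤-refl N≤n s)
  decide (no ¬s) = inj₂ (N , λ n N≤n s → ¬s (close n N N≤n ℕ.≤-refl s))

-- Densities of formulas are determined by the frequencies of ball types

anyVertex : (G : FiniteGraph) → Vertex G
anyVertex G = point (order G) {{FiniteGraph.nonEmpty G}}
  where
  point : ∀ n {{_ : NonZero n}} → Fin n
  point (suc n) = zero

-- Nothing is near the empty tuple, so all laws are vacuous; the maps are still total and take an
-- arbitrary vertex as value.
LocalIso-[] : ∀ G H {r} → LocalIso (graph G) (graph H) r [] []
LocalIso-[] G H = record
  { to = λ _ → anyVertex H ; from = λ _ → anyVertex G
  ; to-root = λ () ; from-root = λ ()
  ; from∘to = λ () ; to∘from = λ ()
  ; to-adj = λ () ; from-adj = λ () }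

Radius≤⇒Connected : ∀ {r F o} → Radius≤ r F o → Connected (graph F)
Radius≤⇒Connected rad u v with dist-trans (dist-sym (rad u)) (rad v)
... | k , _ , p = k , p

module FromTypes (d : ℕ) (𝒢 : ℕ → FiniteGraph) (deg≤d : ∀ n → MaxDegree≤ d (𝒢 n))
                 (infinite : OrderTendsToInfinity 𝒢) (bs : BSConvergent d 𝒢)
                 (r : ℕ) where
  open Types d r

  private
    s : ℕ
    s = suc (r ℕ.+ r)

    G : ∀ n → Graph (Vertex (𝒢 n))
    G n = graph (𝒢 n)

  τ : ∀ n → Vertex (𝒢 n) → Type
  τ n v = proj₁ (typed (𝒢 n) (deg≤d n) v)

  τ-type : ∀ n v → HasType r (𝒢 n) v (code (τ n v))
  τ-type n v = proj₂ (typed (𝒢 n) (deg≤d n) v)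

  τ≡⇔BallIso : ∀ n v i → BallIso r (𝒢 n) v (codeGraph (code i)) (codeRoot (code i)) ⇔ (τ n v ≡ i)
  τ≡⇔BallIso n v i = mk⇔ (λ I → type-unique (𝒢 n) (τ-type n v) (hasType I))
    (λ { refl → HasType.ballIso (τ-type n v) })

  frequency-Cauchy : ∀ i → IsCauchy≤ (λ n → frequency (𝒢 n) (τ n) i)
  frequency-Cauchy i = IsCauchy≤-resp (λ n → ballDensity r F o (𝒢 n)) frequency≡
    (Converges⇒IsCauchy≤ (λ n → ballDensity r F o (𝒢 n)) (bs r F o (Radius≤⇒Connected {r} {F} {o} (proj₁ (code-isType i))) (proj₂ (code-isType i))))
    where
    F = codeGraph (code i)
    o = codeRoot (code i)
    frequency≡ : ∀ n → ballDensity r F o (𝒢 n) ≡ frequency (𝒢 n) (τ n) i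
    frequency≡ n = trans (ballDensity≡mean r F o (𝒢 n))
      (mean-cong (𝒢 n) (λ v → ind-cong (ball≅? (𝒢 n) v r F o) (τ n v Fin.≟ i) (τ≡⇔BallIso n v i)))

  -- Each entry of a scattered tuple is far from the later ones, so `extend-far` attaches the balls
  -- one at a time.
  scattered⇒LocalIso : ∀ m n {p} {ρ : Vec (Vertex (𝒢 m)) p} {σ : Vec (Vertex (𝒢 n)) p} →
    Scattered (𝒢 m) s ρ → Scattered (𝒢 n) s σ → Vec.map (τ m) ρ ≡ Vec.map (τ n) σ →
    LocalIso (G m) (G n) r ρ σ
  scattered⇒LocalIso m n {ρ = []}    {[]}    _ _ _ = LocalIso-[] (𝒢 m) (𝒢 n)
  scattered⇒LocalIso m n {ρ = a ∷ ρ} {b ∷ σ} (a-far , ρ-sc) (b-far , σ-sc) eq =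
    extend-far {𝒢 m} {𝒢 n}
      (sameType⇒LocalIso (τ-type m a)
        (subst (λ i → HasType r (𝒢 n) b (code i)) (sym (proj₁ (∷-injective eq))) (τ-type n b)))
      (scattered⇒LocalIso m n ρ-sc σ-sc (proj₂ (∷-injective eq)))
      a-far b-far

  module _ {p} (φ : Formula p) {N : ℕ}
    (local : ∀ m n → N ℕ.≤ m → N ℕ.≤ n →
      {ρ : Vec (Vertex (𝒢 m)) p} {σ : Vec (Vertex (𝒢 n)) p} →
      LocalIso (G m) (G n) r ρ σ → G m ⊨ φ [ ρ ] → G n ⊨ φ [ σ ]) where

    open Sampling d 𝒢 deg≤d infinite s using (clustered; rare-clustered)

    Realised : ℕ → Vec Type p → Set
    Realised n x = ∃ λ ρ → Scattered (𝒢 n) s ρ × Vec.map (τ n) ρ ≡ x × G n ⊨ φ [ ρ ]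

    realised? : ∀ n x → Dec (Realised n x)
    realised? n x = anyTuple? (λ ρ →
      scattered? (𝒢 n) s ρ ×-dec ≡-dec Fin._≟_ (Vec.map (τ n) ρ) x ×-dec sat? (𝒢 n) φ ρ)

    realised⇒sat : ∀ m n → N ℕ.≤ m → N ℕ.≤ n → ∀ {σ} → Scattered (𝒢 n) s σ →
      Realised m (Vec.map (τ n) σ) → G n ⊨ φ [ σ ]
    realised⇒sat m n N≤m N≤n σ-sc (ρ , ρ-sc , eq , sat) =
      local m n N≤m N≤n (scattered⇒LocalIso m n ρ-sc σ-sc eq) sat

    -- It is undecidable which types are realised in some later graph, so the
    -- two densities are compared through the types realised in one of the two.
    module _ (m n : ℕ) (N≤m : N ℕ.≤ m) (N≤n : N ℕ.≤ n) where

      realisedEither? : ∀ x → Dec (Realised m x ⊎ Realised n x)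
      realisedEither? x = realised? m x ⊎-dec realised? n x

      F : Vec Type p → ℚ
      F x = ind (realisedEither? x)

      sat⇔F : ∀ k → N ℕ.≤ k → (∀ {x} → Realised k x → Realised m x ⊎ Realised n x) →
        ∀ ρ → Scattered (𝒢 k) s ρ →
        (G k ⊨ φ [ ρ ]) ⇔ (Realised m (Vec.map (τ k) ρ) ⊎ Realised n (Vec.map (τ k) ρ))
      sat⇔F k N≤k include ρ sc = mk⇔ (λ sat → include (ρ , sc , refl , sat))
        (λ { (inj₁ R) → realised⇒sat m k N≤m N≤k sc R
           ; (inj₂ R) → realised⇒sat n k N≤n N≤k sc R })

      -- On scattered tuples the two indicators agree by `sat⇔F`; elsewhere they differ by at most
      -- 1.
      density-close : ∀ k → N ℕ.≤ k → (∀ {x} → Realised k x → Realised m x ⊎ Realised n x) →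
        ∣ ⟨ φ , 𝒢 k ⟩ - expect (𝒢 k) p (λ ρ → F (Vec.map (τ k) ρ)) ∣ ≤ clustered p k
      density-close k N≤k include =
        subst (λ q → ∣ q - expect (𝒢 k) p (λ ρ → F (Vec.map (τ k) ρ)) ∣ ≤ clustered p k)
          (sym (⟨⟩≡expect φ (𝒢 k)))
          (expect-diff (𝒢 k) p (λ ρ → ind-diff (sat? (𝒢 k) φ ρ) (realisedEither? (Vec.map (τ k) ρ))
            (¬? (scattered? (𝒢 k) s ρ))
            (λ ¬¬sc → sat⇔F k N≤k include ρ (decidable-stable (scattered? (𝒢 k) s ρ) ¬¬sc))))

    density-Cauchy : IsCauchy≤ (λ n → ⟨ φ , 𝒢 n ⟩)
    density-Cauchy ε ε>0 =
      -- A quarter of `ε` goes to the clustered tuples of each graph, and the remaining half to the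
      -- change of graph.
      let η = half ε
          (L , rare)  = rare-clustered p (half η) (half>0 (half>0 ε>0))
          (M , close) = expect-Cauchy 𝒢 τ frequency-Cauchy p η (half>0 ε>0)
          K = N ⊔ (L ⊔ M)
          N≤K = ℕ.m≤m⊔n N (L ⊔ M)
          L≤K = ℕ.≤-trans (ℕ.m≤m⊔n L M) (ℕ.m≤n⊔m N (L ⊔ M))
          M≤K = ℕ.≤-trans (ℕ.m≤n⊔m L M) (ℕ.m≤n⊔m N (L ⊔ M))
      in K , λ m n K≤m K≤n →
        let N≤m = ℕ.≤-trans N≤K K≤m
            N≤n = ℕ.≤-trans N≤K K≤n
            a = ⟨ φ , 𝒢 m ⟩
            b = expect (𝒢 m) p (λ ρ → F m n N≤m N≤n (Vec.map (τ m) ρ))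
            c = expect (𝒢 n) p (λ ρ → F m n N≤m N≤n (Vec.map (τ n) ρ))
            e = ⟨ φ , 𝒢 n ⟩
            ab = ℚ.≤-trans (density-close m n N≤m N≤n m N≤m inj₁) (rare m (ℕ.≤-trans L≤K K≤m))
            bc = close m n (ℕ.≤-trans M≤K K≤m) (ℕ.≤-trans M≤K K≤n) (F m n N≤m N≤n)
                   (λ x → ∣ind∣≤1 (realisedEither? m n N≤m N≤n x))
            ce = ℚ.≤-trans (ℚ.≤-reflexive (∣-∣-sym c e))
                   (ℚ.≤-trans (density-close m n N≤m N≤n n N≤n inj₂) (rare n (ℕ.≤-trans L≤K K≤n)))
            ae = ∣-∣-triangle {a} {b} {e} ab (∣-∣-triangle {b} {c} {e} bc ce)
        in ℚ.≤-trans ae (ℚ.≤-reflexive (regroup ε))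
      where
      open ≡-Reasoning
      regroup : ∀ ε → half (half ε) + (half ε + half (half ε)) ≡ ε
      regroup ε = begin
        half (half ε) + (half ε + half (half ε)) ≡⟨ cong (λ x → half (half ε) + x) (ℚ.+-comm (half ε) _) ⟩
        half (half ε) + (half (half ε) + half ε) ≡⟨ ℚ.+-assoc (half (half ε)) _ _ ⟨
        half (half ε) + half (half ε) + half ε   ≡⟨ cong (λ x → x + half ε) (half+half (half ε)) ⟩
        half ε + half ε                          ≡⟨ half+half ε ⟩
        ε                                        ∎

BS∧elementary⇒FO : ∀ d 𝒢 → (∀ n → MaxDegree≤ d (𝒢 n)) → OrderTendsToInfinity 𝒢 →
  BSConvergent d 𝒢 → ElementarilyConvergent 𝒢 → FOConvergent 𝒢
BS∧elementary⇒FO d 𝒢 deg≤d infinite bs elementary φ =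
  -- Elementary convergence yields the radius `r`, which determines the finitely many ball types
  -- whose densities BS-convergence then controls.
  let (r , N , local) = Locality.locality d 𝒢 deg≤d elementary φ in
  IsCauchy⇒Converges (λ n → ⟨ φ , 𝒢 n ⟩) (IsCauchy≤⇒IsCauchy (λ n → ⟨ φ , 𝒢 n ⟩)
    (FromTypes.density-Cauchy d 𝒢 deg≤d infinite bs r φ local))

theorem5p18 : (d : ℕ) (G : ℕ → FiniteGraph) →
    (∀ n → MaxDegree≤ d (G n)) →
    OrderTendsToInfinity G →
    FOConvergent G ⇔ (BSConvergent d G × ElementarilyConvergent G)
theorem5p18 d G deg≤d infinite = mk⇔
  (λ fo → FO⇒BS d G fo , FO⇒elementary G fo)
  (λ (bs , elementary) → BS∧elementary⇒FO d G deg≤d infinite bs elementary)
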